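{- For every integer $k\ge 3$, there are infinitely many $(2k-2)$-connected essentially $(4k-6)$-edge-connected $(2k-2)$-regular simple graphs $G$ with $|E(G)|$ divisible by $k$ which admit no $k$-star-decomposition.
   Context: A simple graph has no loops and no multiple edges. A graph is essentially $\lambda$-edge-connected if, for every edge cut of size strictly less than $\lambda$, all edges of the cut are incident with a common vertex. A $k$-star is the star $K_{1,k}$ (one center vertex joined to $k$ leaves); a $k$-star-decomposition of $G$ is a partition of $E(G)$ into edge sets each of which forms a copy of $K_{1,k}$. -}

module Defs where

open import Data.Nat using (ℕ; zero; suc; _+_; _<_; _<ᵇ_)
open import Data.Fin using (Fin; zero; suc; toℕ)
open import Data.Bool using (Bool; true; false; if_then_else_; _∧_; not)
open import Data.Product using (Σ; ∃; _×_)
open import Data.Sum using (_⊎_)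
open import Relation.Binary.PropositionalEquality using (_≡_)
open import Function using (_∘_)

record Graph (n : ℕ) : Set where
  field
    adj    : Fin n → Fin n → Bool
    sym    : ∀ u v → adj u v ≡ adj v u
    irrefl : ∀ u → adj u u ≡ false
open Graph public

count : ∀ {n} → (Fin n → Bool) → ℕ
count {zero}  p = 0
count {suc n} p = (if p zero then 1 else 0) + count (p ∘ suc)

sumF : ∀ {n} → (Fin n → ℕ) → ℕ
sumF {zero}  f = 0
sumF {suc n} f = f zero + sumF (f ∘ suc)

degree : ∀ {n} → Graph n → Fin n → ℕ
degree G u = count (adj G u)

Regular : ∀ {n} → ℕ → Graph n → Set
Regular d G = ∀ u → degree G u ≡ d

edgeCount : ∀ {n} → Graph n → ℕ
edgeCount G = sumF (λ u → count (λ v → adj G u v ∧ (toℕ u <ᵇ toℕ v)))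

data Reach {n} (G : Graph n) (ok : Fin n → Bool) : Fin n → Fin n → Set where
  here : ∀ {u} → Reach G ok u u
  step : ∀ {u w v} → adj G u w ≡ true → ok w ≡ true → Reach G ok w v → Reach G ok u v

ConnectedWithout : ∀ {n} → Graph n → (Fin n → Bool) → Set
ConnectedWithout G S = ∀ u v → S u ≡ false → S v ≡ false → Reach G (not ∘ S) u v

VertexConnected : ∀ {n} → ℕ → Graph n → Set
VertexConnected {n} κ G = κ < n × (∀ S → count S < κ → ConnectedWithout G S)

cutSize : ∀ {n} → Graph n → (Fin n → Bool) → ℕ
cutSize G X = sumF (λ u → if X u then count (λ v → not (X v) ∧ adj G u v) else 0)

EssEdgeConnected : ∀ {n} → ℕ → Graph n → Set
EssEdgeConnected λ' G = ∀ X → cutSize G X < λ' →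
  ∃ λ w → ∀ u v → X u ≡ true → X v ≡ false → adj G u v ≡ true → (u ≡ w ⊎ v ≡ w)

record Star {n} (k : ℕ) (G : Graph n) : Set where
  field
    center   : Fin n
    leaf     : Fin k → Fin n
    leaf-inj : ∀ i j → leaf i ≡ leaf j → i ≡ j
    leaf-adj : ∀ i → adj G center (leaf i) ≡ true
open Star public

InStar : ∀ {n k} {G : Graph n} → Star k G → Fin n → Fin n → Set
InStar s u v = (u ≡ center s × ∃ λ i → leaf s i ≡ v) ⊎ (v ≡ center s × ∃ λ i → leaf s i ≡ u)

StarDecomposition : ∀ {n} → ℕ → Graph n → Set
StarDecomposition {n} k G =
  Σ ℕ λ m → Σ (Fin m → Star k G) λ stars →
    (∀ u v → adj G u v ≡ true → ∃ λ i → InStar (stars i) u v) ×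
    (∀ u v i j → InStar (stars i) u v → InStar (stars j) u v → i ≡ j)

{-# OPTIONS --safe #-}

-- Take q = 2k - 3 and arrange m copies of a fixed graph, the block, in a ring, joining the q right
-- ports of each copy to the q left ports of the next one.  For k ≥ 4 the block is K_q and every vertex
-- is both a left and a right port, so the graph is the Cartesian product of K_q and a cycle.  For k = 3
-- the independence number of K_q is exactly b/k, where b is the number of vertices of the block, and
-- the block is the Moser spindle instead, with six of its seven vertices as ports.  Both choices
-- have independence number less than b/k.  But in a (2k-2)-regular graph on n vertices the non-centres
-- of a k-star-decomposition form an independent set of at least n/k vertices.
--
-- Connectivity reduces to inequalities about vertex sets of a single block.  If an edge cut separates one
-- whole layer from another, each of the q cyclic columns through the ports contributes two edges;
-- otherwise the layers met by one side are cut internally.  If q vertices are deleted, then all layers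
-- but one lose fewer than q/2 vertices each, so they stay connected and linked to their neighbours.
module Submission where

open import Defs
open import Algebra.Properties.CommutativeSemigroup using (interchange)
open import Data.Bool using (Bool; true; false; if_then_else_; _∧_; _∨_; not)
import Data.Bool as Bool
open import Data.Bool.Properties using (∧-comm; ∧-conicalˡ; ∧-conicalʳ; ∧-inverseʳ; ∨-comm; ∨-zeroʳ; not-involutive; ¬-not)
open import Data.Empty using (⊥; ⊥-elim)
open import Data.Fin using (Fin; zero; suc; toℕ; fromℕ; inject₁; _↑ˡ_; _↑ʳ_; combine; remQuot; _≟_; #_)
open import Data.Fin.Induction using (<-weakInduction; >-weakInduction)
open import Data.Fin.Properties using (all?; any?; toℕ-injective; toℕ-inject₁; injective⇒≤; combine-remQuot; remQuot-combine)
open import Data.Fin.Relation.Unary.Top using (view; ‵fromℕ; ‵inject₁; view-fromℕ; view-inject₁)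
open import Data.Nat using (ℕ; zero; suc; _+_; _∸_; _*_; _≤_; _<_; _<ᵇ_; z≤n; s≤s)
import Data.Nat as ℕ
open import Data.Nat.Divisibility using (_∣_; divides; ∣m⇒∣m*n; ∣m+n∣m⇒∣n)
open import Data.Nat.Properties hiding (_≟_; suc-injective; 0≢1+n)
open import Data.Nat.Tactic.RingSolver using (solve-∀)
open import Data.Product using (Σ; ∃; _×_; _,_; proj₁; proj₂)
open import Data.Sum using (_⊎_; inj₁; inj₂)
open import Data.Vec using (Vec; []; _∷_; lookup; tabulate)
open import Function using (_∘_; id; case_of_)
open import Relation.Binary using (tri<; tri≈; tri>)
open import Relation.Binary.PropositionalEquality using (_≡_; _≢_; refl; trans; cong; cong₂; subst; subst₂; module ≡-Reasoning)
import Relation.Binary.PropositionalEquality as ≡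
open import Relation.Nullary using (¬_; Dec; yes; no; does; contradiction)
open import Relation.Nullary.Decidable using (dec-true; dec-false; from-yes; map′; decidable-stable; ¬?; _×-dec_; _⊎-dec_; _→-dec_)

private
  variable
    m n p : ℕ

-- Finite sums and counts

infix 8 _==_

_==_ : Fin n → Fin n → Bool
i == j = does (i ≟ j)

==-refl : (i : Fin n) → i == i ≡ true
==-refl i = dec-true (i ≟ i) refl

==-true : {i j : Fin n} → i == j ≡ true → i ≡ j
==-true {i = i} {j} e with yes i≡j ← i ≟ j = i≡j

==-false : {i j : Fin n} → i ≢ j → i == j ≡ false
==-false {i = i} {j} = dec-false (i ≟ j)

==-sym : (i j : Fin n) → i == j ≡ j == i
==-sym i j with i ≟ j
... | yes refl = ≡.sym (==-refl i)
... | no i≢j = ≡.sym (==-false (i≢j ∘ ≡.sym))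

⟦_⟧ : Bool → ℕ
⟦ b ⟧ = if b then 1 else 0

⟦∧⟧ : ∀ a b → ⟦ a ∧ b ⟧ ≡ ⟦ a ⟧ * ⟦ b ⟧
⟦∧⟧ true  b = ≡.sym (+-identityʳ _)
⟦∧⟧ false b = refl

⟦not⟧ : ∀ a → ⟦ a ⟧ + ⟦ not a ⟧ ≡ 1
⟦not⟧ true  = refl
⟦not⟧ false = refl

⟦⟧-mono : ∀ {a b} → (a ≡ true → b ≡ true) → ⟦ a ⟧ ≤ ⟦ b ⟧
⟦⟧-mono {false} _ = z≤n
⟦⟧-mono {true}  a⇒b rewrite a⇒b refl = ≤-refl

⟦⟧-< : ∀ {a b} → ⟦ a ⟧ < ⟦ b ⟧ → a ≡ false × b ≡ true
⟦⟧-< {false} {true}  _       = refl , refl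
⟦⟧-< {true}  {true}  (s≤s ())
⟦⟧-< {false} {false} ()

true≢false : ∀ {a} → a ≡ true → a ≡ false → ⊥
true≢false refl ()

sumF-cong : {f g : Fin n → ℕ} → (∀ i → f i ≡ g i) → sumF f ≡ sumF g
sumF-cong {zero}  _  = refl
sumF-cong {suc n} eq = cong₂ _+_ (eq zero) (sumF-cong (eq ∘ suc))

sumF-mono : {f g : Fin n → ℕ} → (∀ i → f i ≤ g i) → sumF f ≤ sumF g
sumF-mono {zero}  _ = z≤n
sumF-mono {suc n} l = +-mono-≤ (l zero) (sumF-mono (l ∘ suc))

sumF-+ : (f g : Fin n → ℕ) → sumF (λ i → f i + g i) ≡ sumF f + sumF g
sumF-+ {zero}  f g = refl
sumF-+ {suc n} f g =
  trans (cong (f zero + g zero +_) (sumF-+ (f ∘ suc) (g ∘ suc)))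
        (interchange +-commutativeSemigroup (f zero) (g zero) (sumF (f ∘ suc)) (sumF (g ∘ suc)))

sumF-* : (c : ℕ) (f : Fin n → ℕ) → sumF (λ i → c * f i) ≡ c * sumF f
sumF-* {zero}  c f = ≡.sym (*-zeroʳ c)
sumF-* {suc n} c f =
  trans (cong (c * f zero +_) (sumF-* c (f ∘ suc))) (≡.sym (*-distribˡ-+ c (f zero) _))

sumF-const : ∀ n c → sumF {n} (λ _ → c) ≡ n * c
sumF-const zero    c = refl
sumF-const (suc n) c = cong (c +_) (sumF-const n c)

sumF-0 : ∀ n → sumF {n} (λ _ → 0) ≡ 0
sumF-0 n = trans (sumF-const n 0) (*-zeroʳ n)

sumF-swap : (f : Fin m → Fin n → ℕ) →
            sumF (λ i → sumF (f i)) ≡ sumF (λ j → sumF (λ i → f i j))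
sumF-swap {zero} {n} f = ≡.sym (sumF-0 n)
sumF-swap {suc m} f =
  trans (cong (sumF (f zero) +_) (sumF-swap (f ∘ suc)))
        (≡.sym (sumF-+ (f zero) (λ j → sumF (λ i → f (suc i) j))))

sumF-δ : (i : Fin n) (f : Fin n → ℕ) → sumF (λ j → ⟦ i == j ⟧ * f j) ≡ f i
sumF-δ {suc n} zero f = begin
  1 * f zero + sumF {n} (λ _ → 0)  ≡⟨ cong (1 * f zero +_) (sumF-0 n) ⟩
  1 * f zero + 0                   ≡⟨ unit ⟩
  f zero                           ∎
  where
  open ≡-Reasoning
  unit : ∀ {x} → 1 * x + 0 ≡ x
  unit = trans (+-identityʳ _) (+-identityʳ _)
sumF-δ {suc n} (suc i) f = sumF-δ i (f ∘ suc)

sumF-≥ : (f : Fin n → ℕ) (i : Fin n) → f i ≤ sumF f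
sumF-≥ f zero    = m≤m+n _ _
sumF-≥ f (suc i) = ≤-trans (sumF-≥ (f ∘ suc) i) (m≤n+m _ (f zero))

-- The pigeonhole principle: if the first index is no witness, cancelling its terms keeps the strict
-- inequality. Undeleted ports are found this way.
sumF-<⇒∃ : (f g : Fin n → ℕ) → sumF f < sumF g → ∃ λ i → f i < g i
sumF-<⇒∃ {suc n} f g lt with f zero <? g zero
... | yes l = zero , l
... | no ¬l with i , l ← sumF-<⇒∃ (f ∘ suc) (g ∘ suc)
                  (+-cancelˡ-< (f zero) _ _ (<-≤-trans lt (+-monoˡ-≤ _ (≮⇒≥ ¬l)))) = suc i , l

sumF-++ : ∀ m (f : Fin (m + n) → ℕ) → sumF f ≡ sumF (f ∘ (_↑ˡ n)) + sumF (f ∘ (m ↑ʳ_))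
sumF-++ zero    f = refl
sumF-++ (suc m) f = trans (cong (f zero +_) (sumF-++ m (f ∘ suc))) (≡.sym (+-assoc (f zero) _ _))

sumF-combine : (f : Fin (m * n) → ℕ) → sumF f ≡ sumF {m} (λ i → sumF {n} (λ v → f (combine i v)))
sumF-combine {zero}      f = refl
sumF-combine {suc m} {n} f =
  trans (sumF-++ n f) (cong (sumF (f ∘ (_↑ˡ (m * n))) +_) (sumF-combine {m} (f ∘ (n ↑ʳ_))))

count-sum : (P : Fin n → Bool) → count P ≡ sumF (λ i → ⟦ P i ⟧)
count-sum {zero}  P = refl
count-sum {suc n} P = cong (⟦ P zero ⟧ +_) (count-sum (P ∘ suc))

count-cong : {P Q : Fin n → Bool} → (∀ i → P i ≡ Q i) → count P ≡ count Q
count-cong {P = P} {Q} eq =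
  trans (count-sum P) (trans (sumF-cong (cong ⟦_⟧ ∘ eq)) (≡.sym (count-sum Q)))

count-mono : {P Q : Fin n → Bool} → (∀ i → P i ≡ true → Q i ≡ true) → count P ≤ count Q
count-mono {P = P} {Q} l rewrite count-sum P | count-sum Q = sumF-mono (⟦⟧-mono ∘ l)

count-none : {P : Fin n → Bool} → (∀ i → P i ≡ false) → count P ≡ 0
count-none {n} none = trans (count-cong none) (trans (count-sum {n} _) (sumF-0 n))

count-not : (P : Fin n → Bool) → count P + count (not ∘ P) ≡ n
count-not {zero}  P = refl
count-not {suc n} P = trans (interchange +-commutativeSemigroup ⟦ P zero ⟧ _ ⟦ not (P zero) ⟧ _)
                            (cong₂ _+_ (⟦not⟧ (P zero)) (count-not (P ∘ suc)))

count-∃ : {P : Fin n → Bool} → 0 < count P → ∃ λ i → P i ≡ true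
count-∃ {n} {P} pos rewrite count-sum P
  with i , lt ← sumF-<⇒∃ (λ _ → 0) (⟦_⟧ ∘ P) (≤-<-trans (≤-reflexive (sumF-0 n)) pos)
  = i , proj₂ (⟦⟧-< {false} lt)

count-pos : {P : Fin n → Bool} {i : Fin n} → P i ≡ true → 0 < count P
count-pos {P = P} {i} Pi rewrite count-sum P = ≤-trans (≤-reflexive (≡.sym (cong ⟦_⟧ Pi))) (sumF-≥ (⟦_⟧ ∘ P) i)

count-δ : (i : Fin n) → count (i ==_) ≡ 1
count-δ i = trans (count-sum (i ==_))
  (trans (sumF-cong (λ j → ≡.sym (*-identityʳ ⟦ i == j ⟧))) (sumF-δ i (λ _ → 1)))

-- Double counting: each `g (f j)` becomes a sum over `v` weighted by `⟦ f j == v ⟧`. After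
-- exchanging the sums, every `v` has weight at most 1, having at most one preimage.
sumF-injective : {f : Fin p → Fin n} → (∀ i j → f i ≡ f j → i ≡ j) →
                 (g : Fin n → ℕ) → sumF (g ∘ f) ≤ sumF g
sumF-injective {p} {n} {f} inj g = begin
  sumF (λ j → g (f j))                                 ≡⟨ sumF-cong (λ j → sumF-δ (f j) g) ⟨
  sumF (λ j → sumF (λ v → ⟦ f j == v ⟧ * g v))         ≡⟨ sumF-swap (λ j v → ⟦ f j == v ⟧ * g v) ⟩
  sumF (λ v → sumF (λ j → ⟦ f j == v ⟧ * g v))         ≡⟨ sumF-cong (λ v → sumF-cong λ j → *-comm ⟦ f j == v ⟧ (g v)) ⟩
  sumF (λ v → sumF (λ j → g v * ⟦ f j == v ⟧))         ≡⟨ sumF-cong (λ v → sumF-* (g v) (λ j → ⟦ f j == v ⟧)) ⟩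
  sumF (λ v → g v * sumF (λ j → ⟦ f j == v ⟧))         ≤⟨ sumF-mono (λ v → *-monoʳ-≤ (g v) (fibre v)) ⟩
  sumF (λ v → g v * 1)                                 ≡⟨ sumF-cong (λ v → *-identityʳ (g v)) ⟩
  sumF g                                               ∎
  where
  open ≤-Reasoning
  fibre : ∀ v → sumF (λ j → ⟦ f j == v ⟧) ≤ 1
  fibre v with any? (λ j → f j ≟ v)
  ... | no ∄ = ≤-trans (≤-reflexive (trans (sumF-cong λ j → cong ⟦_⟧ (==-false (λ e → ∄ (j , e))))
                                       (sumF-0 p))) z≤n
  ... | yes (j₀ , refl) = ≤-trans
    (sumF-mono λ j → ⟦⟧-mono λ e → trans (cong (j₀ ==_) (inj j j₀ (==-true e))) (==-refl j₀))
    (≤-reflexive (trans (≡.sym (count-sum (j₀ ==_))) (count-δ j₀)))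

sumF-pair : (f : Fin n → ℕ) {i j : Fin n} → i ≢ j → f i + f j ≤ sumF f
sumF-pair f {i} {j} i≢j =
  ≤-trans (≤-reflexive (cong (f i +_) (≡.sym (+-identityʳ _)))) (sumF-injective {f = pick} inj f)
  where
  pick : Fin 2 → Fin _
  pick zero = i
  pick (suc zero) = j
  inj : ∀ a b → pick a ≡ pick b → a ≡ b
  inj zero       zero       _ = refl
  inj zero       (suc zero) e = contradiction e i≢j
  inj (suc zero) zero       e = contradiction (≡.sym e) i≢j
  inj (suc zero) (suc zero) _ = refl

sumF-triple : (f : Fin n → ℕ) {i j l : Fin n} → i ≢ j → i ≢ l → j ≢ l → f i + f j + f l ≤ sumF f
sumF-triple f {i} {j} {l} i≢j i≢l j≢l =
  ≤-trans (≤-reflexive (trans (+-assoc (f i) _ _) (cong (λ x → f i + (f j + x)) (≡.sym (+-identityʳ _)))))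
          (sumF-injective {f = pick} inj f)
  where
  pick : Fin 3 → Fin _
  pick zero = i
  pick (suc zero) = j
  pick (suc (suc zero)) = l
  inj : ∀ a b → pick a ≡ pick b → a ≡ b
  inj zero             zero             _ = refl
  inj zero             (suc zero)       e = contradiction e i≢j
  inj zero             (suc (suc zero)) e = contradiction e i≢l
  inj (suc zero)       zero             e = contradiction (≡.sym e) i≢j
  inj (suc zero)       (suc zero)       _ = refl
  inj (suc zero)       (suc (suc zero)) e = contradiction e j≢l
  inj (suc (suc zero)) zero             e = contradiction (≡.sym e) i≢l
  inj (suc (suc zero)) (suc zero)       e = contradiction (≡.sym e) j≢l
  inj (suc (suc zero)) (suc (suc zero)) _ = refl

-- Graphs

degree-sum : (G : Graph n) (u : Fin n) → degree G u ≡ sumF (λ v → ⟦ adj G u v ⟧)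
degree-sum G u = count-sum (adj G u)

-- The product form lets the two sums be exchanged and regrouped by layers and ports.
cut-sum : (G : Graph n) (X : Fin n → Bool) →
          cutSize G X ≡ sumF (λ u → sumF (λ v → ⟦ X u ⟧ * (⟦ adj G u v ⟧ * ⟦ not (X v) ⟧)))
cut-sum {n} G X = sumF-cong λ u → trans (row u) (≡.sym (sumF-* ⟦ X u ⟧ (λ v → ⟦ adj G u v ⟧ * ⟦ not (X v) ⟧)))
  where
  row : ∀ u → (if X u then count (λ v → not (X v) ∧ adj G u v) else 0) ≡
              ⟦ X u ⟧ * sumF (λ v → ⟦ adj G u v ⟧ * ⟦ not (X v) ⟧)
  row u with X u
  ... | false = refl
  ... | true  = begin
    count (λ v → not (X v) ∧ adj G u v)              ≡⟨ count-cong (λ v → ∧-comm (not (X v)) (adj G u v)) ⟩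
    count (λ v → adj G u v ∧ not (X v))              ≡⟨ count-sum (λ v → adj G u v ∧ not (X v)) ⟩
    sumF (λ v → ⟦ adj G u v ∧ not (X v) ⟧)           ≡⟨ sumF-cong (λ v → ⟦∧⟧ (adj G u v) (not (X v))) ⟩
    sumF (λ v → ⟦ adj G u v ⟧ * ⟦ not (X v) ⟧)       ≡⟨ +-identityʳ _ ⟨
    1 * sumF (λ v → ⟦ adj G u v ⟧ * ⟦ not (X v) ⟧)   ∎
    where open ≡-Reasoning

cut-not : (G : Graph n) (X : Fin n → Bool) → cutSize G (not ∘ X) ≡ cutSize G X
cut-not G X = begin
  cutSize G (not ∘ X)
    ≡⟨ cut-sum G (not ∘ X) ⟩
  sumF (λ u → sumF (λ v → ⟦ not (X u) ⟧ * (⟦ adj G u v ⟧ * ⟦ not (not (X v)) ⟧)))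
    ≡⟨ sumF-swap (λ u v → ⟦ not (X u) ⟧ * (⟦ adj G u v ⟧ * ⟦ not (not (X v)) ⟧)) ⟩
  sumF (λ v → sumF (λ u → ⟦ not (X u) ⟧ * (⟦ adj G u v ⟧ * ⟦ not (not (X v)) ⟧)))
    ≡⟨ sumF-cong (λ v → sumF-cong (λ u → flip v u)) ⟩
  sumF (λ v → sumF (λ u → ⟦ X v ⟧ * (⟦ adj G v u ⟧ * ⟦ not (X u) ⟧)))
    ≡⟨ cut-sum G X ⟨
  cutSize G X ∎
  where
  open ≡-Reasoning
  rearrange : ∀ a b c → a * (b * c) ≡ c * (b * a)
  rearrange = solve-∀
  flip : ∀ v u → ⟦ not (X u) ⟧ * (⟦ adj G u v ⟧ * ⟦ not (not (X v)) ⟧) ≡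
                 ⟦ X v ⟧ * (⟦ adj G v u ⟧ * ⟦ not (X u) ⟧)
  flip v u rewrite not-involutive (X v) | sym G u v = rearrange ⟦ not (X u) ⟧ ⟦ adj G v u ⟧ ⟦ X v ⟧

-- Ordered adjacent pairs split into increasing and decreasing ones; exchanging the sums matches the
-- two kinds.
handshake : (G : Graph n) → sumF (degree G) ≡ edgeCount G + edgeCount G
handshake {n} G = begin
  sumF (degree G)
    ≡⟨ sumF-cong (degree-sum G) ⟩
  sumF (λ u → sumF (λ v → ⟦ adj G u v ⟧))
    ≡⟨ sumF-cong (λ u → trans (sumF-cong (split u)) (sumF-+ (λ v → up u v) (λ v → up v u))) ⟩
  sumF (λ u → sumF (λ v → up u v) + sumF (λ v → up v u))
    ≡⟨ sumF-+ (λ u → sumF (up u)) (λ u → sumF (λ v → up v u)) ⟩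
  sumF (λ u → sumF (up u)) + sumF (λ u → sumF (λ v → up v u))
    ≡⟨ cong (sumF (λ u → sumF (up u)) +_) (sumF-swap up) ⟨
  sumF (λ u → sumF (up u)) + sumF (λ u → sumF (up u))
    ≡⟨ cong₂ _+_ ups ups ⟨
  edgeCount G + edgeCount G ∎
  where
  open ≡-Reasoning
  up : Fin n → Fin n → ℕ
  up u v = ⟦ adj G u v ∧ (toℕ u <ᵇ toℕ v) ⟧
  ups : edgeCount G ≡ sumF (λ u → sumF (up u))
  ups = sumF-cong λ u → count-sum (λ v → adj G u v ∧ (toℕ u <ᵇ toℕ v))
  split : ∀ u v → ⟦ adj G u v ⟧ ≡ up u v + up v u
  split u v with <-cmp (toℕ u) (toℕ v)
  ... | tri≈ _ e _ rewrite toℕ-injective e | irrefl G v = refl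
  ... | tri< l _ l′ rewrite sym G v u | dec-true (toℕ u <? toℕ v) l | dec-false (toℕ v <? toℕ u) l′ with adj G u v
  ...   | true = refl
  ...   | false = refl
  split u v | tri> l′ _ l rewrite sym G v u | dec-true (toℕ v <? toℕ u) l | dec-false (toℕ u <? toℕ v) l′ with adj G u v
  ...   | true = refl
  ...   | false = refl

-- Closed vertex sets and connectivity after deletions.

Closed : Graph n → (K S : Fin n → Bool) → Set
Closed G K S = ∀ u v → K u ≡ true → adj G u v ≡ true → S v ≡ false → K v ≡ true

-- Together with `Closed G K S` this makes `K` a union of components of `G` minus `S`.
Avoids : (K S : Fin n → Bool) → Set
Avoids K S = ∀ v → K v ≡ true → S v ≡ false

_∪[_] : (Fin n → Bool) → Fin n → Fin n → Bool
(K ∪[ w ]) v = K v ∨ w == v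

count-∪ : (K : Fin n → Bool) {w : Fin n} → K w ≡ false → count (K ∪[ w ]) ≡ suc (count K)
count-∪ K {w} w∉K = begin
  count (K ∪[ w ])                      ≡⟨ count-sum (K ∪[ w ]) ⟩
  sumF (λ v → ⟦ K v ∨ w == v ⟧)         ≡⟨ sumF-cong split ⟩
  sumF (λ v → ⟦ w == v ⟧ + ⟦ K v ⟧)     ≡⟨ sumF-+ (λ v → ⟦ w == v ⟧) (⟦_⟧ ∘ K) ⟩
  _                                     ≡⟨ cong₂ _+_ (count-sum (w ==_)) (count-sum K) ⟨
  count (w ==_) + count K               ≡⟨ cong (_+ count K) (count-δ w) ⟩
  suc (count K)                         ∎
  where
  open ≡-Reasoning
  split : ∀ v → ⟦ K v ∨ w == v ⟧ ≡ ⟦ w == v ⟧ + ⟦ K v ⟧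
  split v with w ≟ v
  ... | yes refl rewrite w∉K = refl
  ... | no _ with K v
  ...   | true  = refl
  ...   | false = refl

reach-snoc : {G : Graph n} {ok : Fin n → Bool} {u v w : Fin n} →
             Reach G ok u v → adj G v w ≡ true → ok w ≡ true → Reach G ok u w
reach-snoc here         e o = step e o here
reach-snoc (step e o r) f q = step e o (reach-snoc r f q)

module _ (G : Graph n) (S : Fin n → Bool) (u : Fin n) where

  private
    Sound : (Fin n → Bool) → Set
    Sound K = ∀ v → K v ≡ true → S v ≡ false × Reach G (not ∘ S) u v

    -- Each round adds one undeleted neighbour of `K`. The invariant `n ≤ fuel + count K` makes the
    -- fuel last until there is none, and then `K` is closed.
    grow : (fuel : ℕ) (K : Fin n → Bool) → n ≤ fuel + count K → K u ≡ true → Sound K →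
           ∃ λ K → K u ≡ true × Sound K × Closed G K S
    grow fuel K enough u∈K sound
      with any? (λ v → any? (λ w → (K v Bool.≟ true ×-dec adj G v w Bool.≟ true) ×-dec
                                   (S w Bool.≟ false ×-dec K w Bool.≟ false)))
    ... | no ∄ = K , u∈K , sound , closed
      where
      closed : Closed G K S
      closed v w v∈K vw w∉S with K w in w∈?K
      ... | true  = refl
      ... | false = contradiction (v , w , (v∈K , vw) , w∉S , w∈?K) ∄
    grow zero K enough _ _ | yes (_ , w , _ , _ , w∉K) =
      contradiction enough (<⇒≱ (<-≤-trans (m<m+n (count K) (count-pos {P = not ∘ K} {w} (cong not w∉K)))
                                            (≤-reflexive (count-not K))))
    grow (suc fuel) K enough u∈K sound | yes (v , w , (v∈K , vw) , w∉S , w∉K) =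
      grow fuel (K ∪[ w ])
        (≤-trans enough (≤-reflexive (trans (≡.sym (+-suc fuel _)) (cong (fuel +_) (≡.sym (count-∪ K w∉K))))))
        (cong (_∨ w == u) u∈K) sound′
      where
      sound′ : Sound (K ∪[ w ])
      sound′ x x∈ with K x in x∈?K
      ... | true = sound x x∈?K
      ... | false with refl ← ==-true {i = w} x∈ =
        w∉S , reach-snoc (proj₂ (sound v v∈K)) vw (cong not w∉S)

  component : S u ≡ false → ∃ λ K → K u ≡ true × Sound K × Closed G K S
  component u∉S = grow n (u ==_) (m≤m+n n _) (==-refl u) start
    where
    start : Sound (u ==_)
    start v e with refl ← ==-true {i = u} e = u∉S , here

-- Without a path from `u` to `v`, the component of `u` and the set of all other undeleted vertices
-- are disjoint and closed. Later arguments thus deal with closed sets instead of paths.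
inseparable⇒connected : (G : Graph n) (S : Fin n → Bool) →
  (∀ K K′ → Closed G K S → Closed G K′ S → Avoids K S → Avoids K′ S →
     (∀ v → K v ≡ true → K′ v ≡ false) → ∀ u v → K u ≡ true → K′ v ≡ true → ⊥) →
  ConnectedWithout G S
inseparable⇒connected G S insep u v u∉S v∉S
  with K , u∈K , sound , closed ← component G S u u∉S with K v in v∈?K
... | true  = proj₂ (sound v v∈?K)
... | false = ⊥-elim (insep K rest closed closed′ (λ x → proj₁ ∘ sound x) avoids disjoint u v u∈K v∈rest)
  where
  rest : Fin _ → Bool
  rest x = not (K x ∨ S x)
  v∈rest : rest v ≡ true
  v∈rest rewrite v∈?K | v∉S = refl
  disjoint : ∀ x → K x ≡ true → rest x ≡ false
  disjoint x x∈K rewrite x∈K = refl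
  avoids : Avoids rest S
  avoids x x∈ with K x | S x
  ... | false | false = refl
  closed′ : Closed G rest S
  closed′ x y x∈ xy y∉S with K y in y∈?K
  ... | false rewrite y∉S = refl
  ... | true = ⊥-elim (true≢false x∈ (disjoint x (closed y x y∈?K (trans (sym G y x) xy) (avoids x x∈))))

-- Star decompositions and independent sets.

Independent : Graph n → (Fin n → Bool) → Set
Independent G I = ∀ u v → I u ≡ true → I v ≡ true → adj G u v ≡ false

-- Every centre accounts for k edges of a star of its own; comparing 2k · #centres with the degree sum
-- leaves at least n/k non-centres.
no-star-decomposition : ∀ {k d} (G : Graph n) → Regular d G → 2 * k ≡ 2 + d →
                        (∀ I → Independent G I → k * count I < n) → ¬ StarDecomposition k G
no-star-decomposition {n} {k} {d} G regular 2k≡2+d α (s , stars , cover , disjoint) =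
  <⇒≱ (α (not ∘ isCentre) independent) n≤k|I|
  where
  centre? : ∀ u → Dec (∃ λ i → center (stars i) ≡ u)
  centre? u = any? (λ i → center (stars i) ≟ u)
  isCentre : Fin n → Bool
  isCentre u = does (centre? u)

  -- Every edge lies in a star, so one of its ends is a centre.
  independent : Independent G (not ∘ isCentre)
  independent u v u∈I v∈I with adj G u v in uv
  ... | false = refl
  ... | true with cover u v uv
  ...   | i , inj₁ (refl , _) = contradiction (dec-true (centre? u) (i , refl)) λ e → true≢false u∈I (cong not e)
  ...   | i , inj₂ (refl , _) = contradiction (dec-true (centre? v) (i , refl)) λ e → true≢false v∈I (cong not e)

  leaf? : ∀ i v → Dec (∃ λ j → leaf (stars i) j ≡ v)
  leaf? i v = any? (λ j → leaf (stars i) j ≟ v)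

  -- Several stars may share a centre; `out u` marks the leaves of the single star that `centre?`
  -- returns.
  out : Fin n → Fin n → Bool
  out u v with centre? u
  ... | yes (i , _) = does (leaf? i v)
  ... | no _ = false

  out⇒ : ∀ u v → out u v ≡ true → ∃ λ i → center (stars i) ≡ u × ∃ λ j → leaf (stars i) j ≡ v
  out⇒ u v e with centre? u
  ... | yes (i , c) with yes l ← leaf? i v = i , c , l

  out-count : ∀ u → k * ⟦ isCentre u ⟧ ≤ count (out u)
  out-count u with centre? u
  ... | no _ = ≤-trans (≤-reflexive (*-zeroʳ k)) z≤n
  ... | yes (i , _) = begin
    k * 1                                          ≡⟨ sumF-const k 1 ⟨
    sumF {k} (λ _ → 1)                             ≡⟨ sumF-cong (λ j → cong ⟦_⟧ (dec-true (leaf? i (leaf (stars i) j)) (j , refl))) ⟨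
    sumF (λ j → ⟦ does (leaf? i (leaf (stars i) j)) ⟧)  ≤⟨ sumF-injective (leaf-inj (stars i)) (λ v → ⟦ does (leaf? i v) ⟧) ⟩
    sumF (λ v → ⟦ does (leaf? i v) ⟧)              ≡⟨ count-sum (λ v → does (leaf? i v)) ⟨
    count (λ v → does (leaf? i v))                 ∎
    where open ≤-Reasoning

  out-adj : ∀ u v → ⟦ out u v ⟧ + ⟦ out v u ⟧ ≤ ⟦ adj G u v ⟧
  out-adj u v with out u v in uv | out v u in vu
  ... | false | false = z≤n
  ... | true | false with i , refl , j , refl ← out⇒ u v uv rewrite leaf-adj (stars i) j = ≤-refl
  ... | false | true with i , refl , j , refl ← out⇒ v u vu
      rewrite sym G (leaf (stars i) j) (center (stars i)) | leaf-adj (stars i) j = ≤-refl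
  -- Two marked orientations put the edge in two stars, which disjointness identifies; the centre
  -- would then be one of its own leaves.
  ... | true | true with i , refl , j , refl ← out⇒ u v uv | i′ , c′ , l′ ← out⇒ v u vu
      with refl ← disjoint _ _ i i′ (inj₁ (refl , j , refl)) (inj₂ (≡.sym c′ , l′)) =
        ⊥-elim (true≢false (leaf-adj (stars i) j)
          (trans (cong (adj G (center (stars i))) (≡.sym c′)) (irrefl G _)))

  total : k * count isCentre + k * count isCentre ≤ n * d
  total = begin
    k * count isCentre + k * count isCentre
      ≤⟨ +-mono-≤ centres centres ⟩
    sumF (λ u → sumF (λ v → ⟦ out u v ⟧)) + sumF (λ u → sumF (λ v → ⟦ out u v ⟧))
      ≡⟨ cong (sumF (λ u → sumF (λ v → ⟦ out u v ⟧)) +_) (sumF-swap (λ u v → ⟦ out u v ⟧)) ⟩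
    sumF (λ u → sumF (λ v → ⟦ out u v ⟧)) + sumF (λ u → sumF (λ v → ⟦ out v u ⟧))
      ≡⟨ sumF-+ (λ u → sumF (λ v → ⟦ out u v ⟧)) (λ u → sumF (λ v → ⟦ out v u ⟧)) ⟨
    sumF (λ u → sumF (λ v → ⟦ out u v ⟧) + sumF (λ v → ⟦ out v u ⟧))
      ≡⟨ sumF-cong (λ u → sumF-+ (λ v → ⟦ out u v ⟧) (λ v → ⟦ out v u ⟧)) ⟨
    sumF (λ u → sumF (λ v → ⟦ out u v ⟧ + ⟦ out v u ⟧))
      ≤⟨ sumF-mono (λ u → sumF-mono (out-adj u)) ⟩
    sumF (λ u → sumF (λ v → ⟦ adj G u v ⟧))
      ≡⟨ sumF-cong (λ u → trans (≡.sym (degree-sum G u)) (regular u)) ⟩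
    sumF {n} (λ _ → d)
      ≡⟨ sumF-const n d ⟩
    n * d ∎
    where
    open ≤-Reasoning
    centres : k * count isCentre ≤ sumF (λ u → sumF (λ v → ⟦ out u v ⟧))
    centres = begin
      k * count isCentre                       ≡⟨ cong (k *_) (count-sum isCentre) ⟩
      k * sumF (λ u → ⟦ isCentre u ⟧)          ≡⟨ sumF-* k (λ u → ⟦ isCentre u ⟧) ⟨
      sumF (λ u → k * ⟦ isCentre u ⟧)          ≤⟨ sumF-mono out-count ⟩
      sumF (λ u → count (out u))               ≡⟨ sumF-cong (λ u → count-sum (out u)) ⟩
      sumF (λ u → sumF (λ v → ⟦ out u v ⟧))    ∎

  -- With `C` centres and `I` non-centres, `2 * k ≡ 2 + d` gives 2n + nd = 2kC + 2kI, and 2kC ≤ nd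
  -- leaves n ≤ kI.
  n≤k|I| : n ≤ k * count (not ∘ isCentre)
  n≤k|I| = *-cancelʳ-≤ n _ 2 (+-cancelʳ-≤ (n * d) _ _ (begin
    n * 2 + n * d                    ≡⟨ *-distribˡ-+ n 2 d ⟨
    n * (2 + d)                      ≡⟨ cong (n *_) 2k≡2+d ⟨
    n * (2 * k)                      ≡⟨ cong (_* (2 * k)) (count-not isCentre) ⟨
    (C + I) * (2 * k)                ≡⟨ expand C I k ⟩
    k * I * 2 + (k * C + k * C)      ≤⟨ +-monoʳ-≤ (k * I * 2) total ⟩
    k * I * 2 + n * d                ∎))
    where
    open ≤-Reasoning
    C I : ℕ
    C = count isCentre
    I = count (not ∘ isCentre)
    expand : ∀ C I k → (C + I) * (2 * k) ≡ k * I * 2 + (k * C + k * C)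
    expand = solve-∀

-- Rings of blocks

next prev : Fin (suc n) → Fin (suc n)
next i with view i
... | ‵fromℕ     = zero
... | ‵inject₁ j = suc j
prev zero    = fromℕ _
prev (suc j) = inject₁ j

next-fromℕ : ∀ n → next (fromℕ n) ≡ zero
next-fromℕ n rewrite view-fromℕ n = refl

next-inject₁ : (j : Fin n) → next (inject₁ j) ≡ suc j
next-inject₁ j rewrite view-inject₁ j = refl

next-prev : (i : Fin (suc n)) → next (prev i) ≡ i
next-prev zero    = next-fromℕ _
next-prev (suc j) = next-inject₁ j

prev-next : (i : Fin (suc n)) → prev (next i) ≡ i
prev-next i with view i
... | ‵fromℕ     = refl
... | ‵inject₁ j = refl

suc≢inject₁ : (j : Fin n) → suc j ≢ inject₁ j
suc≢inject₁ j e = 1+n≢n (trans (cong toℕ e) (toℕ-inject₁ j))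

next≢ : (i : Fin (2 + n)) → next i ≢ i
next≢ i with view i
... | ‵fromℕ     = λ ()
... | ‵inject₁ j = suc≢inject₁ j

prev≢ : (i : Fin (2 + n)) → prev i ≢ i
prev≢ i e = next≢ (prev i) (trans (next-prev i) (≡.sym e))

next≢prev : (i : Fin (3 + n)) → next i ≢ prev i
next≢prev i with view i
... | ‵fromℕ           = λ ()
... | ‵inject₁ zero    = λ ()
... | ‵inject₁ (suc j) = λ e → m+1+n≢n 1 (trans (cong toℕ e) (trans (toℕ-inject₁ (inject₁ j)) (toℕ-inject₁ j)))

==-prev : (i j : Fin (suc n)) → prev i == j ≡ next j == i
==-prev i j with prev i ≟ j
... | yes refl = ≡.sym (trans (cong (_== i) (next-prev i)) (==-refl i))
... | no ≢j    = ≡.sym (==-false {i = next j} {i} λ e → ≢j (trans (cong prev (≡.sym e)) (prev-next j)))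

-- From `i` climb to the last index, wrap round to `zero`, then climb to `j`.
next-closed⇒all : (P : Fin (suc n) → Set) → (∀ i → P i → P (next i)) → ∀ i j → P i → P j
next-closed⇒all {n} P closed i j Pi =
  <-weakInduction P (subst P (next-fromℕ n) (closed _ Plast))
    (λ l → subst P (next-inject₁ l) ∘ closed (inject₁ l)) j
  where
  Plast : P (fromℕ n)
  Plast = >-weakInduction (λ i → P i → P (fromℕ n)) id
            (λ l up → up ∘ subst P (next-inject₁ l) ∘ closed (inject₁ l)) i Pi

-- Closure under `prev` makes the predicate `P x → P j` closed under `next`; it holds trivially at
-- `j`.
prev-closed⇒all : (P : Fin (suc n) → Set) → (∀ i → P i → P (prev i)) → ∀ i j → P i → P j
prev-closed⇒all P closed i j =
  next-closed⇒all (λ x → P x → P j)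
    (λ x up → up ∘ subst P (prev-next x) ∘ closed (next x)) j i id

-- Comparing everything with next o avoids a case distinction on the position of o.
around : (o : Fin (2 + n)) (P : Fin (2 + n) → Set) →
         (∀ i → i ≢ o → next i ≢ o → P i → P (next i)) →
         (∀ i → i ≢ o → next i ≢ o → P (next i) → P i) →
         ∀ i j → i ≢ o → j ≢ o → P i → P j
around o P up down i j i≢o j≢o =
  next-closed⇒all From from (next o) j (λ _ → id) j≢o ∘
  next-closed⇒all To to (next o) i (λ _ → id) i≢o
  where
  To From : Fin _ → Set
  To   x = x ≢ o → P x → P (next o)
  From x = x ≢ o → P (next o) → P x
  to : ∀ x → To x → To (next x)
  to x h nx≢o with x ≟ o
  ... | yes refl = id
  ... | no x≢o   = h x≢o ∘ down x x≢o nx≢o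
  from : ∀ x → From x → From (next x)
  from x h nx≢o with x ≟ o
  ... | yes refl = id
  ... | no x≢o   = up x x≢o nx≢o ∘ h x≢o

Proper : (Fin n → Bool) → Set
Proper K = (∃ λ v → K v ≡ true) × (∃ λ v → K v ≡ false)

hits : (Fin p → Fin n) → (Fin n → Bool) → ℕ
hits f K = sumF (λ j → ⟦ K (f j) ⟧)

-- In a ring of blocks, port j on the right of a copy is adjacent to port j on the left of the next copy;
-- link is this matching as a relation on vertices.
record Block (k q : ℕ) : Set where
  field
    size  : ℕ
    graph : Graph size
    left right : Fin q → Fin size
    link  : Fin size → Fin size → Bool

  field
    left-injective  : ∀ i j → left i ≡ left j → i ≡ j
    right-injective : ∀ i j → right i ≡ right j → i ≡ j
    link-ports : ∀ j → link (right j) (left j) ≡ true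
    -- Testing against arbitrary weights says that `link` consists of the port pairs and nothing
    -- else; cuts are evaluated in this form.
    link-sum   : (g : Fin size → Fin size → ℕ) →
                 sumF (λ v → sumF (λ w → ⟦ link v w ⟧ * g v w)) ≡ sumF (λ j → g (right j) (left j))
    regular : ∀ v → degree graph v + (count (link v) + count (λ w → link w v)) ≡ suc q
    sparse  : ∀ I → Independent graph I → k * count I < size

    -- This field and the next serve vertex connectivity: the first treats layers that lose few
    -- vertices, the second the one layer that may lose many.
    closed-fills   : ∀ K S → Closed graph K S → 2 * count S < q →
                     ∀ u v → K u ≡ true → S v ≡ false → K v ≡ true
    closed-expands : ∀ K S → Closed graph K S → Avoids K S →
                     ∀ u → K u ≡ true → q < hits right K + hits left K + count S

    cut-columns : ∀ K → sumF (λ j → ⟦ K (left j) ⟧ * ⟦ not (K (right j)) ⟧) +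
                        sumF (λ j → ⟦ K (right j) ⟧ * ⟦ not (K (left j)) ⟧) ≤ cutSize graph K
    -- These bounds follow the shape of a side `X` without full layers: `cut-triple` if `X` meets
    -- all layers, `cut-right` and `cut-left` for two different layers next to empty ones,
    -- `cut-both` with `cut-alone` for an isolated layer plus any other nonempty layer, `cut-pair`
    -- for an isolated layer holding two vertices.
    cut-alone   : ∀ K → Proper K → q ≤ suc (cutSize graph K)
    cut-triple  : ∀ K → Proper K → 2 * q ≤ 3 * cutSize graph K
    cut-right   : ∀ K → Proper K → q ≤ cutSize graph K + hits right K
    cut-left    : ∀ K → Proper K → q ≤ cutSize graph K + hits left K
    cut-both    : ∀ K → Proper K → q < cutSize graph K + (hits right K + hits left K)
    cut-pair    : ∀ K → Proper K → ∀ u v → u ≢ v → K u ≡ true → K v ≡ true →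
                  2 * q ≤ cutSize graph K + (hits right K + hits left K)

-- The ring: adjacency, degrees and independent sets.

module Ring {k q : ℕ} (B : Block k q) (M′ : ℕ) where

  open Block B renaming (size to b; graph to H)

  -- With at least three copies, the next and the previous copy are distinct, and three layers are
  -- available for `cut-triple`.
  M : ℕ
  M = 3 + M′

  vertex : Fin M → Fin b → Fin (M * b)
  vertex = combine

  Adj : Fin M × Fin b → Fin M × Fin b → Bool
  Adj (i , v) (j , w) = i == j ∧ adj H v w ∨ (next i == j ∧ link v w ∨ prev i == j ∧ link w v)

  Adj-sym : ∀ x y → Adj x y ≡ Adj y x
  Adj-sym (i , v) (j , w)
    rewrite ==-sym i j | sym H v w | ==-prev i j | ==-prev j i =
    cong (j == i ∧ adj H w v ∨_) (∨-comm (next i == j ∧ link v w) (next j == i ∧ link w v))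

  Adj-irrefl : ∀ x → Adj x x ≡ false
  Adj-irrefl (i , v) rewrite ==-refl i | irrefl H v | ==-false (next≢ i) | ==-false (prev≢ i) = refl

  ring : Graph (M * b)
  ring .adj u v = Adj (remQuot b u) (remQuot b v)
  ring .sym u v = Adj-sym (remQuot b u) (remQuot b v)
  ring .irrefl u = Adj-irrefl (remQuot b u)

  ring-adj : ∀ i v j w → adj ring (vertex i v) (vertex j w) ≡ Adj (i , v) (j , w)
  ring-adj i v j w = cong₂ Adj (remQuot-combine i v) (remQuot-combine j w)

  ring-adj-inside : ∀ i v w → adj H v w ≡ true → adj ring (vertex i v) (vertex i w) ≡ true
  ring-adj-inside i v w vw rewrite ring-adj i v i w | ==-refl i | vw = refl

  ring-adj-next : ∀ i j → adj ring (vertex i (right j)) (vertex (next i) (left j)) ≡ true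
  ring-adj-next i j
    rewrite ring-adj i (right j) (next i) (left j) | ==-refl (next i) | link-ports j = ∨-zeroʳ _

  ring-adj-prev : ∀ i j → adj ring (vertex i (left j)) (vertex (prev i) (right j)) ≡ true
  ring-adj-prev i j = trans (sym ring _ _)
    (subst (λ x → adj ring (vertex (prev i) (right j)) (vertex x (left j)) ≡ true) (next-prev i)
           (ring-adj-next (prev i) j))

  layer : (Fin (M * b) → Bool) → Fin M → Fin b → Bool
  layer X i v = X (vertex i v)

  at : ∀ (P : Fin (M * b) → Set) → (∀ i v → P (vertex i v)) → ∀ u → P u
  at P h u = subst P (combine-remQuot {M} b u) (h (proj₁ (remQuot {M} b u)) (proj₂ (remQuot {M} b u)))

  -- Since `i`, `next i` and `prev i` are distinct, at most one of the three disjuncts of `Adj`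
  -- holds, so its indicator is a sum.
  Adj-split : ∀ i v j w x → ⟦ Adj (i , v) (j , w) ⟧ * x ≡
    ⟦ i == j ⟧ * (⟦ adj H v w ⟧ * x) +
    (⟦ next i == j ⟧ * (⟦ link v w ⟧ * x) + ⟦ prev i == j ⟧ * (⟦ link w v ⟧ * x))
  Adj-split i v j w x with i ≟ j
  ... | yes refl rewrite ==-false (next≢ i) | ==-false (prev≢ i) with adj H v w
  ...   | true  = units x
    where
    units : ∀ x → 1 * x ≡ 1 * (1 * x) + (0 + 0)
    units = solve-∀
  ...   | false = refl
  Adj-split i v j w x | no _ with next i ≟ j
  ... | yes refl rewrite ==-false (next≢prev i ∘ ≡.sym) with link v w
  ...   | true  = units x
    where
    units : ∀ x → 1 * x ≡ 1 * (1 * x) + 0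
    units = solve-∀
  ...   | false = refl
  Adj-split i v j w x | no _ | no _ with prev i == j | link w v
  ...   | true  | true  = units x
    where
    units : ∀ x → 1 * x ≡ 1 * (1 * x)
    units = solve-∀
  ...   | true  | false = refl
  ...   | false | _     = refl

  -- Weight 1 yields the degree; the indicator of the complement of `X` yields the cut.
  neighbour-sum : ∀ i v (φ : Fin (M * b) → ℕ) →
    sumF (λ u → ⟦ adj ring (vertex i v) u ⟧ * φ u) ≡
    sumF (λ w → ⟦ adj H v w ⟧ * φ (vertex i w)) +
    (sumF (λ w → ⟦ link v w ⟧ * φ (vertex (next i) w)) +
     sumF (λ w → ⟦ link w v ⟧ * φ (vertex (prev i) w)))
  neighbour-sum i v φ = begin
    sumF (λ u → ⟦ adj ring (vertex i v) u ⟧ * φ u)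
      ≡⟨ sumF-combine {M} {b} _ ⟩
    sumF (λ j → sumF (λ w → ⟦ adj ring (vertex i v) (vertex j w) ⟧ * φ (vertex j w)))
      ≡⟨ sumF-cong (λ j → sumF-cong (λ w →
           trans (cong (λ a → ⟦ a ⟧ * φ (vertex j w)) (ring-adj i v j w)) (Adj-split i v j w _))) ⟩
    sumF (λ j → sumF (λ w → ⟦ i == j ⟧ * a j w + (⟦ next i == j ⟧ * b′ j w + ⟦ prev i == j ⟧ * c j w)))
      ≡⟨ sumF-cong (λ j → collect ⟦ i == j ⟧ ⟦ next i == j ⟧ ⟦ prev i == j ⟧ (a j) (b′ j) (c j)) ⟩
    sumF (λ j → ⟦ i == j ⟧ * sumF (a j) + (⟦ next i == j ⟧ * sumF (b′ j) + ⟦ prev i == j ⟧ * sumF (c j)))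
      ≡⟨ sumF-+ (λ j → ⟦ i == j ⟧ * sumF (a j))
                (λ j → ⟦ next i == j ⟧ * sumF (b′ j) + ⟦ prev i == j ⟧ * sumF (c j)) ⟩
    sumF (λ j → ⟦ i == j ⟧ * sumF (a j)) +
    sumF (λ j → ⟦ next i == j ⟧ * sumF (b′ j) + ⟦ prev i == j ⟧ * sumF (c j))
      ≡⟨ cong₂ _+_ (sumF-δ i (sumF ∘ a))
           (trans (sumF-+ (λ j → ⟦ next i == j ⟧ * sumF (b′ j)) (λ j → ⟦ prev i == j ⟧ * sumF (c j)))
                  (cong₂ _+_ (sumF-δ (next i) (sumF ∘ b′)) (sumF-δ (prev i) (sumF ∘ c)))) ⟩
    sumF (a i) + (sumF (b′ (next i)) + sumF (c (prev i))) ∎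
    where
    open ≡-Reasoning
    a b′ c : Fin M → Fin b → ℕ
    a  j w = ⟦ adj H v w ⟧ * φ (vertex j w)
    b′ j w = ⟦ link v w ⟧ * φ (vertex j w)
    c  j w = ⟦ link w v ⟧ * φ (vertex j w)
    collect : ∀ x y z (f g h : Fin b → ℕ) →
              sumF (λ w → x * f w + (y * g w + z * h w)) ≡ x * sumF f + (y * sumF g + z * sumF h)
    collect x y z f g h =
      trans (sumF-+ (λ w → x * f w) (λ w → y * g w + z * h w))
            (cong₂ _+_ (sumF-* x f)
              (trans (sumF-+ (λ w → y * g w) (λ w → z * h w)) (cong₂ _+_ (sumF-* y g) (sumF-* z h))))

  ring-regular : Regular (suc q) ring
  ring-regular = at (λ u → degree ring u ≡ suc q) λ i v → begin
    degree ring (vertex i v)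
      ≡⟨ weighted (adj ring (vertex i v)) ⟩
    sumF (λ u → ⟦ adj ring (vertex i v) u ⟧ * 1)
      ≡⟨ neighbour-sum i v (λ _ → 1) ⟩
    sumF (λ w → ⟦ adj H v w ⟧ * 1) + (sumF (λ w → ⟦ link v w ⟧ * 1) + sumF (λ w → ⟦ link w v ⟧ * 1))
      ≡⟨ cong₂ _+_ (weighted (adj H v)) (cong₂ _+_ (weighted (link v)) (weighted (λ w → link w v))) ⟨
    degree H v + (count (link v) + count (λ w → link w v))
      ≡⟨ regular v ⟩
    suc q ∎
    where
    open ≡-Reasoning
    weighted : ∀ {n} (P : Fin n → Bool) → count P ≡ sumF (λ w → ⟦ P w ⟧ * 1)
    weighted P = trans (count-sum P) (sumF-cong λ w → ≡.sym (*-identityʳ ⟦ P w ⟧))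

  layer-count : ∀ X → count X ≡ sumF (λ i → count (layer X i))
  layer-count X = trans (count-sum X) (trans (sumF-combine {M} {b} _)
    (sumF-cong λ i → ≡.sym (count-sum (layer X i))))

  -- Each layer of an independent set is independent in its block, so `sparse` applies layerwise.
  -- Its strictness is worth 1 per layer, and there is a layer.
  ring-sparse : ∀ I → Independent ring I → k * count I < M * b
  ring-sparse I independent = begin-strict
    k * count I                              ≡⟨ cong (k *_) (layer-count I) ⟩
    k * sumF (λ i → count (layer I i))       ≡⟨ sumF-* k (λ i → count (layer I i)) ⟨
    sumF (λ i → k * count (layer I i))       <⟨ m<n+m _ {M} (s≤s z≤n) ⟩
    M + sumF (λ i → k * count (layer I i))   ≡⟨ cong (_+ sumF {M} (λ i → k * count (layer I i)))
                                                  (trans (sumF-const M 1) (*-identityʳ M)) ⟨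
    sumF {M} (λ _ → 1) + sumF (λ i → k * count (layer I i))  ≡⟨ sumF-+ {M} (λ _ → 1) (λ i → k * count (layer I i)) ⟨
    sumF (λ i → suc (k * count (layer I i))) ≤⟨ sumF-mono (λ i → sparse (layer I i) (inside i)) ⟩
    sumF {M} (λ _ → b)                       ≡⟨ sumF-const M b ⟩
    M * b                                    ∎
    where
    open ≤-Reasoning
    inside : ∀ i → Independent H (layer I i)
    inside i v w v∈I w∈I with adj H v w in vw
    ... | false = refl
    ... | true  = ⊥-elim (true≢false (ring-adj-inside i v w vw) (independent _ _ v∈I w∈I))

  -- Edge cuts of the ring.

  forward backward layerCut : (Fin (M * b) → Bool) → Fin M → ℕ
  forward  X i = sumF (λ j → ⟦ layer X i (right j) ⟧ * ⟦ not (layer X (next i) (left j)) ⟧)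
  backward X i = sumF (λ j → ⟦ layer X i (left j) ⟧ * ⟦ not (layer X (prev i) (right j)) ⟧)
  layerCut X i = cutSize H (layer X i) + (forward X i + backward X i)

  -- Every cut edge is charged to the layer of its end in `X`; it stays in that layer or passes
  -- through a port to the next or previous one.
  ring-cut : ∀ X → cutSize ring X ≡ sumF (layerCut X)
  ring-cut X = trans (cut-sum ring X) (trans (sumF-combine {M} {b} _) (sumF-cong perLayer))
    where
    open ≡-Reasoning
    Y = layer X
    perLayer : ∀ i → sumF (λ v → sumF (λ u → ⟦ Y i v ⟧ * (⟦ adj ring (vertex i v) u ⟧ * ⟦ not (X u) ⟧))) ≡ layerCut X i
    perLayer i = begin
      sumF (λ v → sumF (λ u → ⟦ Y i v ⟧ * (⟦ adj ring (vertex i v) u ⟧ * ⟦ not (X u) ⟧)))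
        ≡⟨ sumF-cong (λ v → trans (sumF-* ⟦ Y i v ⟧ (λ u → ⟦ adj ring (vertex i v) u ⟧ * ⟦ not (X u) ⟧))
             (trans (cong (⟦ Y i v ⟧ *_) (neighbour-sum i v (⟦_⟧ ∘ not ∘ X))) (distribute ⟦ Y i v ⟧ _ _ _))) ⟩
      sumF (λ v → ⟦ Y i v ⟧ * sumF (inside v) + (⟦ Y i v ⟧ * sumF (after v) + ⟦ Y i v ⟧ * sumF (before v)))
        ≡⟨ sumF-+ (λ v → ⟦ Y i v ⟧ * sumF (inside v)) (λ v → ⟦ Y i v ⟧ * sumF (after v) + ⟦ Y i v ⟧ * sumF (before v)) ⟩
      _ ≡⟨ cong (sumF (λ v → ⟦ Y i v ⟧ * sumF (inside v)) +_)
             (sumF-+ (λ v → ⟦ Y i v ⟧ * sumF (after v)) (λ v → ⟦ Y i v ⟧ * sumF (before v))) ⟩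
      sumF (λ v → ⟦ Y i v ⟧ * sumF (inside v)) +
      (sumF (λ v → ⟦ Y i v ⟧ * sumF (after v)) + sumF (λ v → ⟦ Y i v ⟧ * sumF (before v)))
        ≡⟨ cong₂ _+_ insides (cong₂ _+_ afters befores) ⟩
      layerCut X i ∎
      where
      distribute : ∀ x y z w → x * (y + (z + w)) ≡ x * y + (x * z + x * w)
      distribute = solve-∀
      rearrange : ∀ x y z → x * (y * z) ≡ y * (x * z)
      rearrange = solve-∀
      inside after before : Fin b → Fin b → ℕ
      inside v w = ⟦ adj H v w ⟧ * ⟦ not (Y i w) ⟧
      after  v w = ⟦ link v w ⟧ * ⟦ not (Y (next i) w) ⟧
      before v w = ⟦ link w v ⟧ * ⟦ not (Y (prev i) w) ⟧
      insides : sumF (λ v → ⟦ Y i v ⟧ * sumF (inside v)) ≡ cutSize H (Y i)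
      insides = ≡.sym (trans (cut-sum H (Y i)) (sumF-cong λ v → sumF-* ⟦ Y i v ⟧ (inside v)))
      afters : sumF (λ v → ⟦ Y i v ⟧ * sumF (after v)) ≡ forward X i
      afters = trans
        (sumF-cong λ v → trans (≡.sym (sumF-* ⟦ Y i v ⟧ (after v)))
          (sumF-cong λ w → rearrange ⟦ Y i v ⟧ ⟦ link v w ⟧ ⟦ not (Y (next i) w) ⟧))
        (link-sum (λ v w → ⟦ Y i v ⟧ * ⟦ not (Y (next i) w) ⟧))
      befores : sumF (λ v → ⟦ Y i v ⟧ * sumF (before v)) ≡ backward X i
      befores = trans
        (sumF-cong λ v → trans (≡.sym (sumF-* ⟦ Y i v ⟧ (before v)))
          (sumF-cong λ w → rearrange ⟦ Y i v ⟧ ⟦ link w v ⟧ ⟦ not (Y (prev i) w) ⟧))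
        (trans (sumF-swap (λ v w → ⟦ link w v ⟧ * (⟦ Y i v ⟧ * ⟦ not (Y (prev i) w) ⟧)))
               (link-sum (λ w v → ⟦ Y i v ⟧ * ⟦ not (Y (prev i) w) ⟧)))

  Nonempty : (Fin b → Bool) → Set
  Nonempty Y = ∃ λ v → Y v ≡ true

  nonempty? : ∀ Y → Dec (Nonempty Y)
  nonempty? Y = any? λ v → Y v Bool.≟ true

  empty : ∀ Y → ¬ Nonempty Y → ∀ v → Y v ≡ false
  empty Y ∄ v with Y v in e
  ... | true  = contradiction (v , e) ∄
  ... | false = refl

  forward-empty : ∀ X i → ¬ Nonempty (layer X (next i)) → forward X i ≡ hits right (layer X i)
  forward-empty X i ∄ = sumF-cong λ j →
    trans (cong (λ x → ⟦ layer X i (right j) ⟧ * ⟦ not x ⟧) (empty (layer X (next i)) ∄ (left j))) (*-identityʳ _)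

  backward-empty : ∀ X i → ¬ Nonempty (layer X (prev i)) → backward X i ≡ hits left (layer X i)
  backward-empty X i ∄ = sumF-cong λ j →
    trans (cong (λ x → ⟦ layer X i (left j) ⟧ * ⟦ not x ⟧) (empty (layer X (prev i)) ∄ (right j))) (*-identityʳ _)

  -- Each of the q cyclic columns leaves X once in either direction.
  columns-cut : ∀ X f e → (∀ v → layer X f v ≡ true) → ¬ Nonempty (layer X e) → 2 * q ≤ cutSize ring X
  columns-cut X f e full ∄ = begin
    2 * q
      ≡⟨ cong (q +_) (+-identityʳ q) ⟩
    q + q
      ≡⟨ cong₂ _+_ ones ones ⟨
    sumF {q} (λ _ → 1) + sumF {q} (λ _ → 1)
      ≤⟨ +-mono-≤ (sumF-mono rightwards) (sumF-mono leftwards) ⟩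
    sumF (λ j → sumF (λ i → lr i j + rl′ i j)) + sumF (λ j → sumF (λ i → rl i j + lr′ i j))
      ≡⟨ cong₂ _+_ (sumF-swap (λ i j → lr i j + rl′ i j)) (sumF-swap (λ i j → rl i j + lr′ i j)) ⟨
    sumF (λ i → sumF (λ j → lr i j + rl′ i j)) + sumF (λ i → sumF (λ j → rl i j + lr′ i j))
      ≡⟨ sumF-+ (λ i → sumF (λ j → lr i j + rl′ i j)) (λ i → sumF (λ j → rl i j + lr′ i j)) ⟨
    sumF (λ i → sumF (λ j → lr i j + rl′ i j) + sumF (λ j → rl i j + lr′ i j))
      ≤⟨ sumF-mono perLayer ⟩
    sumF (layerCut X)
      ≡⟨ ring-cut X ⟨
    cutSize ring X ∎
    where
    open ≤-Reasoning
    Y = layer X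
    -- Followed rightwards, a column alternates between crossing a layer (`lr`) and a link to the
    -- next layer (`rl′`); `rl` and `lr′` do the same leftwards. Each term records an exit from `X`.
    lr rl lr′ rl′ : Fin M → Fin q → ℕ
    lr  i j = ⟦ Y i (left j) ⟧ * ⟦ not (Y i (right j)) ⟧
    rl  i j = ⟦ Y i (right j) ⟧ * ⟦ not (Y i (left j)) ⟧
    lr′ i j = ⟦ Y i (left j) ⟧ * ⟦ not (Y (prev i) (right j)) ⟧
    rl′ i j = ⟦ Y i (right j) ⟧ * ⟦ not (Y (next i) (left j)) ⟧
    ones : sumF {q} (λ _ → 1) ≡ q
    ones = trans (sumF-const q 1) (*-identityʳ q)
    no-exit : ∀ x y z → ⟦ x ⟧ * ⟦ not y ⟧ + ⟦ y ⟧ * ⟦ not z ⟧ < 1 → x ≡ true → z ≡ true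
    no-exit true true true  _ _ = refl
    no-exit true true false (s≤s ()) _
    no-exit true false _    (s≤s ()) _
    rightwards : ∀ j → 1 ≤ sumF (λ i → lr i j + rl′ i j)
    rightwards j with 1 ≤? sumF (λ i → lr i j + rl′ i j)
    ... | yes l = l
    -- Without an exit, membership in `X` would travel along the column from the full layer `f` to
    -- the empty layer `e`.
    ... | no ¬l = contradiction (left j , next-closed⇒all (λ i → Y i (left j) ≡ true)
      (λ i → no-exit (Y i (left j)) (Y i (right j)) (Y (next i) (left j))
        (≤-<-trans (sumF-≥ (λ i → lr i j + rl′ i j) i) (≰⇒> ¬l))) f e (full (left j))) ∄
    leftwards : ∀ j → 1 ≤ sumF (λ i → rl i j + lr′ i j)
    leftwards j with 1 ≤? sumF (λ i → rl i j + lr′ i j)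
    ... | yes l = l
    ... | no ¬l = contradiction (right j , prev-closed⇒all (λ i → Y i (right j) ≡ true)
      (λ i → no-exit (Y i (right j)) (Y i (left j)) (Y (prev i) (right j))
        (≤-<-trans (sumF-≥ (λ i → rl i j + lr′ i j) i) (≰⇒> ¬l))) f e (full (right j))) ∄
    regroup : ∀ x y z w → (x + y) + (z + w) ≡ (x + z) + (y + w)
    regroup = solve-∀
    perLayer : ∀ i → sumF (λ j → lr i j + rl′ i j) + sumF (λ j → rl i j + lr′ i j) ≤ layerCut X i
    perLayer i = begin
      sumF (λ j → lr i j + rl′ i j) + sumF (λ j → rl i j + lr′ i j)
        ≡⟨ cong₂ _+_ (sumF-+ (lr i) (rl′ i)) (sumF-+ (rl i) (lr′ i)) ⟩
      (sumF (lr i) + sumF (rl′ i)) + (sumF (rl i) + sumF (lr′ i))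
        ≡⟨ regroup (sumF (lr i)) (sumF (rl′ i)) (sumF (rl i)) (sumF (lr′ i)) ⟩
      (sumF (lr i) + sumF (rl i)) + (sumF (rl′ i) + sumF (lr′ i))
        ≤⟨ +-monoˡ-≤ (forward X i + backward X i) (cut-columns (Y i)) ⟩
      layerCut X i ∎

  two-layers : ∀ X {i j} → i ≢ j → q ≤ layerCut X i → q ≤ layerCut X j → 2 * q ≤ cutSize ring X
  two-layers X {i} {j} i≢j qi qj = begin
    2 * q                      ≡⟨ cong (q +_) (+-identityʳ q) ⟩
    q + q                      ≤⟨ +-mono-≤ qi qj ⟩
    layerCut X i + layerCut X j ≤⟨ sumF-pair (layerCut X) i≢j ⟩
    sumF (layerCut X)          ≡⟨ ring-cut X ⟨
    cutSize ring X             ∎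
    where open ≤-Reasoning

  -- The exception to the bound `2 * q`: all edges of the cut then meet at `w`. The empty set is
  -- included.
  Concentrated : (Fin (M * b) → Bool) → Set
  Concentrated X = ∃ λ w → ∀ u → X u ≡ true → u ≡ w

  -- If `X` meets all layers, three of them contribute at least two thirds of `q` each. Otherwise,
  -- unless `X` is empty, some nonempty layer `i` precedes an empty one and some nonempty layer `j`
  -- follows one. For `i ≢ j` both contribute `q`; otherwise the layer is isolated.
  no-full-layer : ∀ X → (∀ i → ∃ λ v → layer X i v ≡ false) → 2 * q ≤ cutSize ring X ⊎ Concentrated X
  no-full-layer X ¬full = cases (any? λ i → ¬? (nonempty? (Y i)))
    where
    open ≤-Reasoning
    Y = layer X
    proper : ∀ i → Nonempty (Y i) → Proper (Y i)
    proper i ne = ne , ¬full i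

    inner≤ : ∀ i → cutSize H (Y i) ≤ layerCut X i
    inner≤ i = m≤m+n _ _

    all-nonempty : (∀ i → Nonempty (Y i)) → 2 * q ≤ cutSize ring X
    all-nonempty ne = *-cancelˡ-≤ 3 (begin
      3 * (2 * q)
        ≡⟨ cong (2 * q +_) (cong (2 * q +_) (+-identityʳ _)) ⟩
      2 * q + (2 * q + 2 * q)
        ≤⟨ +-mono-≤ (bound zero) (+-mono-≤ (bound (suc zero)) (bound (suc (suc zero)))) ⟩
      3 * g zero + (3 * g (suc zero) + 3 * g (suc (suc zero)))
        ≡⟨ factor (g zero) (g (suc zero)) (g (suc (suc zero))) ⟩
      3 * (g zero + g (suc zero) + g (suc (suc zero)))
        ≤⟨ *-monoʳ-≤ 3 (sumF-triple g {zero} {suc zero} {suc (suc zero)} (λ ()) (λ ()) (λ ())) ⟩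
      3 * sumF g
        ≡⟨ cong (3 *_) (ring-cut X) ⟨
      3 * cutSize ring X ∎)
      where
      g = layerCut X
      bound : ∀ i → 2 * q ≤ 3 * g i
      bound i = ≤-trans (cut-triple (Y i) (proper i (ne i))) (*-monoʳ-≤ 3 (inner≤ i))
      factor : ∀ x y z → 3 * x + (3 * y + 3 * z) ≡ 3 * (x + y + z)
      factor = solve-∀

    isolated : ∀ i → Nonempty (Y i) → ¬ Nonempty (Y (next i)) → ¬ Nonempty (Y (prev i)) →
               2 * q ≤ cutSize ring X ⊎ Concentrated X
    isolated i (v , v∈) ∄next ∄prev
      with any? (λ u → ¬? (u ≟ v) ×-dec Y i u Bool.≟ true) | any? (λ l → ¬? (l ≟ i) ×-dec nonempty? (Y l))
    ... | yes (u , u≢v , u∈) | _ = inj₁ (begin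
        2 * q                                                ≤⟨ cut-pair (Y i) (proper i (v , v∈)) u v u≢v u∈ v∈ ⟩
        cutSize H (Y i) + (hits right (Y i) + hits left (Y i))
          ≡⟨ cong (cutSize H (Y i) +_) (cong₂ _+_ (forward-empty X i ∄next) (backward-empty X i ∄prev)) ⟨
        layerCut X i                                         ≤⟨ sumF-≥ (layerCut X) i ⟩
        sumF (layerCut X)                                    ≡⟨ ring-cut X ⟨
        cutSize ring X                                       ∎)
    -- The strict `cut-both` makes up for the one edge missing in `cut-alone`.
    ... | no _ | yes (l , l≢i , ne) = inj₁ (≤-pred (begin
        suc (2 * q)                            ≡⟨ cong (λ x → suc (q + x)) (+-identityʳ q) ⟩
        suc q + q                              ≤⟨ +-mono-≤ (cut-both (Y i) (proper i (v , v∈))) (cut-alone (Y l) (proper l ne)) ⟩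
        cutSize H (Y i) + (hits right (Y i) + hits left (Y i)) + suc (cutSize H (Y l))
          ≡⟨ cong (λ x → cutSize H (Y i) + x + suc (cutSize H (Y l)))
               (cong₂ _+_ (forward-empty X i ∄next) (backward-empty X i ∄prev)) ⟨
        layerCut X i + suc (cutSize H (Y l))   ≤⟨ +-monoʳ-≤ (layerCut X i) (s≤s (inner≤ l)) ⟩
        layerCut X i + suc (layerCut X l)      ≡⟨ +-suc (layerCut X i) (layerCut X l) ⟩
        suc (layerCut X i + layerCut X l)      ≤⟨ s≤s (sumF-pair (layerCut X) (l≢i ∘ ≡.sym)) ⟩
        suc (sumF (layerCut X))                ≡⟨ cong suc (ring-cut X) ⟨
        suc (cutSize ring X)                   ∎))
    ... | no only-v | no only-i = inj₂ (vertex i v , at (λ u → X u ≡ true → u ≡ vertex i v) here!)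
      where
      here! : ∀ l x → X (vertex l x) ≡ true → vertex l x ≡ vertex i v
      here! l x x∈ with l ≟ i | x ≟ v
      ... | no l≢i   | _        = contradiction (l , l≢i , x , x∈) only-i
      ... | yes refl | no x≢v   = contradiction (x , x≢v , x∈) only-v
      ... | yes refl | yes refl = refl

    empty-layer : ∀ e → ¬ Nonempty (Y e) → 2 * q ≤ cutSize ring X ⊎ Concentrated X
    empty-layer e ∄ with any? (λ i → nonempty? (Y i) ×-dec ¬? (nonempty? (Y (next i))))
                       | any? (λ i → nonempty? (Y i) ×-dec ¬? (nonempty? (Y (prev i))))
    -- Nonemptiness would propagate to the empty layer `e`, so `X` is empty and any vertex serves as
    -- `w`.
    ... | no ∄exit | _ = inj₂ (vertex e (proj₁ (¬full e)) , at (λ u → X u ≡ true → _) λ i v v∈ →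
      contradiction (next-closed⇒all (Nonempty ∘ Y) (λ l ne → decidable-stable (nonempty? (Y (next l)))
        λ ∄next → ∄exit (l , ne , ∄next)) i e (v , v∈)) ∄)
    ... | yes (i , ne , _) | no ∄exit = contradiction (prev-closed⇒all (Nonempty ∘ Y)
      (λ l ne → decidable-stable (nonempty? (Y (prev l))) λ ∄prev → ∄exit (l , ne , ∄prev)) i e ne) ∄
    ... | yes (i , nei , ∄next) | yes (j , nej , ∄prev) with i ≟ j
    ...   | yes refl = isolated i nei ∄next ∄prev
    ...   | no i≢j = inj₁ (two-layers X i≢j
      (begin
        q                                    ≤⟨ cut-right (Y i) (proper i nei) ⟩
        cutSize H (Y i) + hits right (Y i)   ≡⟨ cong (cutSize H (Y i) +_) (forward-empty X i ∄next) ⟨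
        cutSize H (Y i) + forward X i        ≤⟨ +-monoʳ-≤ (cutSize H (Y i)) (m≤m+n _ _) ⟩
        layerCut X i                         ∎)
      (begin
        q                                    ≤⟨ cut-left (Y j) (proper j nej) ⟩
        cutSize H (Y j) + hits left (Y j)    ≡⟨ cong (cutSize H (Y j) +_) (backward-empty X j ∄prev) ⟨
        cutSize H (Y j) + backward X j       ≤⟨ +-monoʳ-≤ (cutSize H (Y j)) (m≤n+m _ _) ⟩
        layerCut X j                         ∎))

    cases : Dec (∃ λ i → ¬ Nonempty (Y i)) → 2 * q ≤ cutSize ring X ⊎ Concentrated X
    cases (yes (e , ∄)) = empty-layer e ∄
    cases (no ∄empty)   = inj₁ (all-nonempty λ i → decidable-stable (nonempty? (Y i)) λ ∄ → ∄empty (i , ∄))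

  -- A full layer together with an empty one is handled by the columns. Otherwise `X` or its
  -- complement has no full layer, and both have the same cut size.
  ring-essential : EssEdgeConnected (2 * q) ring
  ring-essential X small
    with any? (λ i → ¬? (nonempty? (not ∘ layer X i))) | any? (λ i → ¬? (nonempty? (layer X i)))
  ... | yes (f , full) | yes (e , ∄) =
    contradiction small (≤⇒≯ (columns-cut X f e (λ v → not-false (empty (not ∘ layer X f) full v)) ∄))
    where
    not-false : ∀ {x} → not x ≡ false → x ≡ true
    not-false {true} _ = refl
  ... | no ¬full | _ with no-full-layer X (λ i → not-true i (decidable-stable (nonempty? (not ∘ layer X i)) λ ∄ → ¬full (i , ∄)))
    where
    not-true : ∀ i → Nonempty (not ∘ layer X i) → ∃ λ v → layer X i v ≡ false
    not-true i (v , e) = v , trans (≡.sym (not-involutive _)) (cong not e)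
  ...   | inj₁ big        = contradiction small (≤⇒≯ big)
  ...   | inj₂ (w , only) = w , λ u v u∈ _ _ → inj₁ (only u u∈)
  ring-essential X small | yes _ | no ¬empty
    with no-full-layer (not ∘ X) (λ i → not-true i (decidable-stable (nonempty? (layer X i)) λ ∄ → ¬empty (i , ∄)))
    where
    not-true : ∀ i → Nonempty (layer X i) → ∃ λ v → not (layer X i v) ≡ false
    not-true i (v , e) = v , cong not e
  ...   | inj₁ big        = contradiction small (≤⇒≯ (≤-trans big (≤-reflexive (cut-not ring X))))
  ...   | inj₂ (w , only) = w , λ u v _ v∉ _ → inj₂ (only v (cong not v∉))

  -- Vertex deletions in the ring.

  hits-≤ : ∀ {f : Fin q → Fin b} → (∀ i j → f i ≡ f j → i ≡ j) → ∀ X → hits f X ≤ count X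
  hits-≤ inj X = ≤-trans (sumF-injective inj (⟦_⟧ ∘ X)) (≤-reflexive (≡.sym (count-sum X)))

  module _ (S : Fin (M * b) → Bool) (|S|≤q : count S ≤ q) (o : Fin M)
           (small : ∀ i → i ≢ o → 2 * count (layer S i) < q) where

    private
      s : Fin M → ℕ
      s i = count (layer S i)

      ∑s≤q : sumF s ≤ q
      ∑s≤q = ≤-trans (≤-reflexive (≡.sym (layer-count S))) |S|≤q

      -- Each of the two layers loses less than half of `q`, so together they block fewer than `q`
      -- links.
      free-link : ∀ i → i ≢ o → next i ≢ o →
                  ∃ λ j → layer S i (right j) ≡ false × layer S (next i) (left j) ≡ false
      free-link i i≢o n≢o with sumF-<⇒∃ (λ j → ⟦ layer S i (right j) ⟧ + ⟦ layer S (next i) (left j) ⟧) (λ _ → 1) (begin-strict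
          sumF (λ j → ⟦ layer S i (right j) ⟧ + ⟦ layer S (next i) (left j) ⟧)
            ≡⟨ sumF-+ (λ j → ⟦ layer S i (right j) ⟧) (λ j → ⟦ layer S (next i) (left j) ⟧) ⟩
          hits right (layer S i) + hits left (layer S (next i))
            ≤⟨ +-mono-≤ (hits-≤ right-injective (layer S i)) (hits-≤ left-injective (layer S (next i))) ⟩
          s i + s (next i)
            <⟨ *-cancelˡ-< 2 (s i + s (next i)) q (≤-<-trans (≤-reflexive (*-distribˡ-+ 2 (s i) (s (next i))))
                (<-≤-trans (+-mono-< {2 * s i} {q} (small i i≢o) (small (next i) n≢o)) (≤-reflexive (cong (q +_) (≡.sym (+-identityʳ q)))))) ⟩
          q
            ≡⟨ trans (sumF-const q 1) (*-identityʳ q) ⟨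
          sumF {q} (λ _ → 1) ∎)
        where open ≤-Reasoning
      ... | j , lt = j , both lt
        where
        both : ∀ {x y} → ⟦ x ⟧ + ⟦ y ⟧ < 1 → x ≡ false × y ≡ false
        both {false} {false} _ = refl , refl
        both {true}  {_}     (s≤s ())
        both {false} {true}  (s≤s ())

      module Spread (K : Fin (M * b) → Bool) (closed : Closed ring K S) (avoids : Avoids K S) where

        inside : ∀ i → Closed H (layer K i) (layer S i)
        inside i v w v∈ vw w∉S = closed _ _ v∈ (ring-adj-inside i v w vw) w∉S

        fill : ∀ i → i ≢ o → Nonempty (layer K i) → ∀ v → layer S i v ≡ false → layer K i v ≡ true
        fill i i≢o (u , u∈) v = closed-fills (layer K i) (layer S i) (inside i) (small i i≢o) u v u∈

        up : ∀ i → i ≢ o → next i ≢ o → Nonempty (layer K i) → Nonempty (layer K (next i))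
        up i i≢o n≢o ne with j , r , l ← free-link i i≢o n≢o =
          left j , closed _ _ (fill i i≢o ne (right j) r) (ring-adj-next i j) l

        down : ∀ i → i ≢ o → next i ≢ o → Nonempty (layer K (next i)) → Nonempty (layer K i)
        down i i≢o n≢o ne with j , r , l ← free-link i i≢o n≢o =
          right j , closed _ _ (fill (next i) n≢o ne (left j) l) (trans (sym ring _ _) (ring-adj-next i j)) r

        -- A link leads out of `K` in layer `o` to an undeleted vertex if `K` has more right ports
        -- there than the next layer has deletions, or likewise on the left. Otherwise
        -- `closed-expands` forces more than `q` deletions in three layers.
        escape : ∀ v → K (vertex o v) ≡ true → ∃ λ i → i ≢ o × Nonempty (layer K i)
        escape v v∈ with s (next o) <? hits right (layer K o) | s (prev o) <? hits left (layer K o)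
        ... | yes more | _
            with j , lt ← sumF-<⇒∃ (λ j → ⟦ layer S (next o) (left j) ⟧) (λ j → ⟦ layer K o (right j) ⟧)
                            (≤-<-trans (hits-≤ left-injective (layer S (next o))) more)
            with j∉S , j∈K ← ⟦⟧-< {layer S (next o) (left j)} lt =
          next o , next≢ o , left j , closed _ _ j∈K (ring-adj-next o j) j∉S
        ... | no _ | yes more
            with j , lt ← sumF-<⇒∃ (λ j → ⟦ layer S (prev o) (right j) ⟧) (λ j → ⟦ layer K o (left j) ⟧)
                            (≤-<-trans (hits-≤ right-injective (layer S (prev o))) more)
            with j∉S , j∈K ← ⟦⟧-< {layer S (prev o) (right j)} lt =
          prev o , prev≢ o , right j , closed _ _ j∈K (ring-adj-prev o j) j∉S
        ... | no ¬r | no ¬l = contradiction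
            (closed-expands (layer K o) (layer S o) (inside o) (λ x → avoids _) v v∈) (≤⇒≯ (begin
              hits right (layer K o) + hits left (layer K o) + s o
                ≤⟨ +-monoˡ-≤ (s o) (+-mono-≤ (≮⇒≥ ¬r) (≮⇒≥ ¬l)) ⟩
              s (next o) + s (prev o) + s o
                ≤⟨ sumF-triple s (next≢prev o) (next≢ o) (prev≢ o) ⟩
              sumF s
                ≤⟨ ∑s≤q ⟩
              q ∎))
          where open ≤-Reasoning

        outside-o : ∀ u → K u ≡ true → ∃ λ i → i ≢ o × Nonempty (layer K i)
        outside-o = at (λ u → K u ≡ true → _) λ i v v∈ → case i ≟ o of λ where
          (yes refl) → escape v v∈
          (no i≢o)   → i , i≢o , v , v∈

        everywhere : ∀ u → K u ≡ true → ∀ i → i ≢ o → Nonempty (layer K i)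
        everywhere u u∈ j j≢o with i , i≢o , ne ← outside-o u u∈ =
          around o (Nonempty ∘ layer K) up down i j i≢o j≢o ne

    -- Both closed sets reach the layer `next o`. The first contains all its undeleted vertices,
    -- hence also one of the second.
    connected-without : ConnectedWithout ring S
    connected-without = inseparable⇒connected ring S λ K K′ closed closed′ avoids avoids′ disjoint u v u∈ v∈ →
      let open Spread K closed avoids
          w , w∈K′ = Spread.everywhere K′ closed′ avoids′ v v∈ (next o) (next≢ o)
          w∈K = fill (next o) (next≢ o) (everywhere u u∈ (next o) (next≢ o)) w (avoids′ _ w∈K′)
      in true≢false w∈K′ (disjoint _ w∈K)

  ring-connected : 2 * k ≡ 3 + q → VertexConnected (suc q) ring
  ring-connected 2k≡3+q = large , connected
    where
    open ≤-Reasoning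
    -- `3 + q` is even, so `q` is odd.
    odd : ∀ x → 2 * x ≢ q
    odd x 2x≡q = even≢odd k (suc x) (trans 2k≡3+q (trans (cong (3 +_) (≡.sym 2x≡q)) (shift x)))
      where
      shift : ∀ x → 3 + 2 * x ≡ suc (2 * suc x)
      shift = solve-∀

    q≤b : q ≤ b
    q≤b = injective⇒≤ (λ {i} {j} → left-injective i j)

    large : suc q < M * b
    large = begin-strict
      suc q        <⟨ +-monoˡ-≤ q (*-monoʳ-≤ 2 (n≢0⇒n>0 (odd 0 ∘ ≡.sym))) ⟩
      2 * q + q    ≡⟨ +-comm (2 * q) q ⟩
      3 * q        ≤⟨ *-mono-≤ (m≤m+n 3 M′) q≤b ⟩
      M * b        ∎

    connected : ∀ S → count S < suc q → ConnectedWithout ring S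
    connected S (s≤s |S|≤q) with any? (λ i → q <? 2 * count (layer S i))
    -- With no heavy layer the exceptional one is arbitrary; oddness of `q` turns `≤` into `<`.
    ... | no ∄ = connected-without S |S|≤q zero λ i _ →
      ≤∧≢⇒< (≮⇒≥ λ lt → ∄ (i , lt)) (odd (count (layer S i)))
    ... | yes (o , heavy) = connected-without S |S|≤q o λ i i≢o →
      -- A layer losing more than half of `q` leaves less than half for any other.
      +-cancelʳ-< (2 * s o) _ _ (begin-strict
        2 * s i + 2 * s o   ≡⟨ *-distribˡ-+ 2 (s i) (s o) ⟨
        2 * (s i + s o)     ≤⟨ *-monoʳ-≤ 2 (sumF-pair s i≢o) ⟩
        2 * sumF s          ≡⟨ cong (2 *_) (layer-count S) ⟨
        2 * count S         ≤⟨ *-monoʳ-≤ 2 |S|≤q ⟩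
        2 * q               ≡⟨ cong (q +_) (+-identityʳ q) ⟩
        q + q               <⟨ +-monoʳ-< q heavy ⟩
        q + 2 * s o         ∎)
      where
      s : Fin M → ℕ
      s i = count (layer S i)

  ring-no-decomposition : 2 * k ≡ 3 + q → ¬ StarDecomposition k ring
  ring-no-decomposition 2k≡3+q = no-star-decomposition ring ring-regular 2k≡3+q ring-sparse

  -- Twice the edge count is `M * b * suc q`, and `2 * k ≡ 2 + suc q` turns this into
  -- `M * k * b ≡ M * b + edgeCount ring`, where `k` divides the other two terms.
  ring-edges : 2 * k ≡ 3 + q → k ∣ M → k ∣ edgeCount ring
  ring-edges 2k≡3+q k∣M = ∣m+n∣m⇒∣n (subst (k ∣_) eq (∣m⇒∣m*n b (∣m⇒∣m*n k k∣M))) (∣m⇒∣m*n b k∣M)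
    where
    open ≡-Reasoning
    regroup : ∀ M b q → M * b * 2 + M * b * suc q ≡ M * b * (3 + q)
    regroup = solve-∀
    double : ∀ M b k → M * b * (2 * k) ≡ 2 * (M * k * b)
    double = solve-∀
    half : ∀ x e → x * 2 + (e + e) ≡ 2 * (x + e)
    half = solve-∀
    eq : M * k * b ≡ M * b + edgeCount ring
    eq = *-cancelˡ-≡ _ _ 2 (begin
      2 * (M * k * b)                                    ≡⟨ double M b k ⟨
      M * b * (2 * k)                                    ≡⟨ cong (M * b *_) 2k≡3+q ⟩
      M * b * (3 + q)                                    ≡⟨ regroup M b q ⟨
      M * b * 2 + M * b * suc q                          ≡⟨ cong (M * b * 2 +_) (sumF-const (M * b) (suc q)) ⟨
      M * b * 2 + sumF {M * b} (λ _ → suc q)             ≡⟨ cong (M * b * 2 +_) (sumF-cong ring-regular) ⟨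
      M * b * 2 + sumF (degree ring)                     ≡⟨ cong (M * b * 2 +_) (handshake ring) ⟩
      M * b * 2 + (edgeCount ring + edgeCount ring)      ≡⟨ half (M * b) (edgeCount ring) ⟩
      2 * (M * b + edgeCount ring)                       ∎)

-- The two blocks

complete : ∀ n → Graph n
complete n .adj u v = not (u == v)
complete n .sym u v = cong not (==-sym u v)
complete n .irrefl u = cong not (==-refl u)

complete-adj : {u v : Fin n} → u ≢ v → adj (complete n) u v ≡ true
complete-adj u≢v = cong not (==-false u≢v)

complete-cut : (K : Fin n → Bool) → cutSize (complete n) K ≡ count K * count (not ∘ K)
complete-cut {n} K = begin
  cutSize (complete n) K                       ≡⟨ sumF-cong row ⟩
  sumF (λ u → count (not ∘ K) * ⟦ K u ⟧)       ≡⟨ sumF-* (count (not ∘ K)) (⟦_⟧ ∘ K) ⟩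
  count (not ∘ K) * sumF (⟦_⟧ ∘ K)             ≡⟨ cong (count (not ∘ K) *_) (count-sum K) ⟨
  count (not ∘ K) * count K                    ≡⟨ *-comm (count (not ∘ K)) (count K) ⟩
  count K * count (not ∘ K)                    ∎
  where
  open ≡-Reasoning
  row : ∀ u → (if K u then count (λ v → not (K v) ∧ not (u == v)) else 0) ≡ count (not ∘ K) * ⟦ K u ⟧
  row u with K u in u∈
  ... | false = ≡.sym (*-zeroʳ (count (not ∘ K)))
  ... | true  = trans (count-cong outside) (≡.sym (*-identityʳ _))
    where
    outside : ∀ v → not (K v) ∧ not (u == v) ≡ not (K v)
    outside v with K v in v∈
    ... | true  = refl
    ... | false = complete-adj {u = u} {v} λ where refl → true≢false u∈ v∈

proper-counts : {K : Fin n → Bool} → Proper K → 0 < count K × 0 < count (not ∘ K)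
proper-counts {K = K} ((u , u∈) , v , v∉) = count-pos {P = K} {u} u∈ , count-pos {P = not ∘ K} {v} (cong not v∉)

count-pair : {K : Fin n → Bool} {u v : Fin n} → u ≢ v → K u ≡ true → K v ≡ true → 2 ≤ count K
count-pair {K = K} u≢v u∈ v∈ = ≤-trans
  (≤-reflexive (≡.sym (cong₂ _+_ (cong ⟦_⟧ u∈) (cong ⟦_⟧ v∈))))
  (≤-trans (sumF-pair (⟦_⟧ ∘ K) u≢v) (≤-reflexive (≡.sym (count-sum K))))

-- An inequality is proved by naming the difference, which leaves an identity for the ring solver.
slack : ∀ {x y} d → x + d ≡ y → x ≤ y
slack {x} d refl = m≤m+n x d

-- This is (x - 1)(y - 1) ≥ 0. Here and in the next four lemmas `x` and `y` stand for the sizes of a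
-- proper set and its complement, so `x + y` is `q` and `x * y` is the cut in the complete graph.
sum≤1+product : ∀ {x y} → 0 < x → 0 < y → x + y ≤ suc (x * y)
sum≤1+product {suc a} {suc e} _ _ = slack (a * e) (eq a e)
  where
  eq : ∀ a e → suc a + suc e + a * e ≡ suc (suc a * suc e)
  eq = solve-∀

2sum≤3product : ∀ {x y} → 0 < x → 0 < y → 3 ≤ x + y → 2 * (x + y) ≤ 3 * (x * y)
-- The pair (1, 1) violates the bound; `3 ≤ x + y` excludes it.
2sum≤3product {suc zero} {suc zero} _ _ (s≤s (s≤s ()))
2sum≤3product {suc zero} {suc (suc e)} _ _ _ = slack e (eq e)
  where
  eq : ∀ e → 2 * (1 + suc (suc e)) + e ≡ 3 * (1 * suc (suc e))
  eq = solve-∀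
2sum≤3product {suc (suc a)} {suc e} _ _ _ = slack (a + 4 * e + 3 * (a * e)) (eq a e)
  where
  eq : ∀ a e → 2 * (suc (suc a) + suc e) + (a + 4 * e + 3 * (a * e)) ≡ 3 * (suc (suc a) * suc e)
  eq = solve-∀

sum≤product+ : ∀ {x y} → 0 < x → 0 < y → x + y ≤ x * y + x
sum≤product+ {suc a} {suc e} _ _ = slack (a + a * e) (eq a e)
  where
  eq : ∀ a e → suc a + suc e + (a + a * e) ≡ suc a * suc e + suc a
  eq = solve-∀

sum<product++ : ∀ {x y} → 0 < x → 0 < y → x + y < x * y + (x + x)
sum<product++ {suc a} {suc e} _ _ = slack (2 * a + a * e) (eq a e)
  where
  eq : ∀ a e → suc (suc a + suc e) + (2 * a + a * e) ≡ suc a * suc e + (suc a + suc a)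
  eq = solve-∀

2sum≤product++ : ∀ {x y} → 2 ≤ x → 0 < y → 2 * (x + y) ≤ x * y + (x + x)
2sum≤product++ {suc (suc a)} {suc e} _ _ = slack (a + a * e) (eq a e)
  where
  eq : ∀ a e → 2 * (suc (suc a) + suc e) + (a + a * e) ≡ suc (suc a) * suc e + (suc (suc a) + suc (suc a))
  eq = solve-∀
2sum≤product++ {suc zero} (s≤s ())

-- An independent set has at most one vertex, so `k < q` gives sparsity; `3 ≤ q` enters through
-- `cut-triple`, which fails on two vertices.
complete-block : ∀ {k q} → k < q → 3 ≤ q → Block k q
complete-block {k} {q} k<q 3≤q = record
  { size            = q
  ; graph           = complete q
  ; left            = id
  ; right           = id
  ; link            = _==_
  ; left-injective  = λ _ _ → id
  ; right-injective = λ _ _ → id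
  ; link-ports      = ==-refl
  ; link-sum        = λ g → sumF-cong λ v → sumF-δ v (g v)
  ; regular         = regular
  ; sparse          = sparse
  ; closed-fills    = λ K S closed _ → fills K S closed
  ; closed-expands  = expands
  ; cut-columns     = columns
  ; cut-alone       = λ K proper → let x>0 , y>0 = proper-counts proper in
      bound K (λ s c → s ≤ suc c) (sum≤1+product x>0 y>0)
  ; cut-triple      = λ K proper → let x>0 , y>0 = proper-counts proper in
      bound K (λ s c → 2 * s ≤ 3 * c) (2sum≤3product x>0 y>0 (≤-trans 3≤q (≤-reflexive (≡.sym (count-not K)))))
  ; cut-right       = one-side
  ; cut-left        = one-side
  ; cut-both        = λ K proper → let x>0 , y>0 = proper-counts proper in
      subst (λ h → q < cutSize (complete q) K + (h + h)) (count-sum K)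
        (bound K (λ s c → s < c + (count K + count K)) (sum<product++ x>0 y>0))
  ; cut-pair        = λ K proper u v u≢v u∈ v∈ →
      subst (λ h → 2 * q ≤ cutSize (complete q) K + (h + h)) (count-sum K)
        (bound K (λ s c → 2 * s ≤ c + (count K + count K))
          (2sum≤product++ (count-pair {K = K} u≢v u∈ v∈) (proj₂ (proper-counts proper))))
  }
  where
  regular : ∀ v → count (λ w → not (v == w)) + (count (v ==_) + count (_== v)) ≡ suc q
  regular v = begin
    count (λ w → not (v == w)) + (count (v ==_) + count (_== v))
      ≡⟨ cong (λ x → count (λ w → not (v == w)) + (count (v ==_) + x))
           (trans (count-cong (λ w → ==-sym w v)) (count-δ v)) ⟩
    count (λ w → not (v == w)) + (count (v ==_) + 1)
      ≡⟨ rotate (count (λ w → not (v == w))) (count (v ==_)) ⟩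
    suc (count (v ==_) + count (λ w → not (v == w)))
      ≡⟨ cong suc (count-not (v ==_)) ⟩
    suc q ∎
    where
    open ≡-Reasoning
    rotate : ∀ x y → x + (y + 1) ≡ suc (y + x)
    rotate = solve-∀

  sparse : ∀ I → Independent (complete q) I → k * count I < q
  sparse I independent = ≤-<-trans (*-monoʳ-≤ k at-most-one) (≤-<-trans (≤-reflexive (*-identityʳ k)) k<q)
    where
    at-most-one : count I ≤ 1
    at-most-one with any? (λ v → I v Bool.≟ true)
    ... | no ∄ = ≤-trans (≤-reflexive (count-none λ v → ¬-not λ v∈ → ∄ (v , v∈))) z≤n
    ... | yes (v , v∈) = ≤-trans (count-mono same) (≤-reflexive (count-δ v))
      where
      same : ∀ w → I w ≡ true → v == w ≡ true
      same w w∈ = trans (≡.sym (not-involutive _)) (cong not (independent v w v∈ w∈))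

  fills : ∀ K S → Closed (complete q) K S → ∀ u v → K u ≡ true → S v ≡ false → K v ≡ true
  fills K S closed u v u∈ v∉S with u ≟ v
  ... | yes refl = u∈
  ... | no u≢v   = closed u v u∈ (complete-adj u≢v) v∉S

  -- `K` and `S` together cover the clique, and the ports count every vertex of the nonempty `K`
  -- twice.
  expands : ∀ K S → Closed (complete q) K S → Avoids K S →
            ∀ u → K u ≡ true → q < hits id K + hits id K + count S
  expands K S closed _ u u∈ = begin-strict
    q                                ≡⟨ count-not K ⟨
    count K + count (not ∘ K)        ≤⟨ +-monoʳ-≤ (count K) (count-mono outside) ⟩
    count K + count S                <⟨ +-monoˡ-< (count S) (m<m+n (count K) (count-pos {P = K} u∈)) ⟩
    count K + count K + count S      ≡⟨ cong (λ h → h + h + count S) (count-sum K) ⟩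
    hits id K + hits id K + count S  ∎
    where
    open ≤-Reasoning
    outside : ∀ v → not (K v) ≡ true → S v ≡ true
    outside v v∉K with S v in v∈?S
    ... | true  = refl
    ... | false = ⊥-elim (true≢false v∉K (cong not (fills K S closed u v u∈ v∈?S)))

  -- The two ports of a column are the same vertex, so no column exits within a layer.
  columns : ∀ K → sumF (λ j → ⟦ K j ⟧ * ⟦ not (K j) ⟧) + sumF (λ j → ⟦ K j ⟧ * ⟦ not (K j) ⟧) ≤
                  cutSize (complete q) K
  columns K = ≤-trans (≤-reflexive (cong₂ _+_ none none)) z≤n
    where
    none : sumF (λ j → ⟦ K j ⟧ * ⟦ not (K j) ⟧) ≡ 0
    none = trans (sumF-cong λ j → trans (≡.sym (⟦∧⟧ (K j) (not (K j)))) (cong ⟦_⟧ (∧-inverseʳ (K j))))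
                 (sumF-0 q)

  bound : ∀ K (P : ℕ → ℕ → Set) → P (count K + count (not ∘ K)) (count K * count (not ∘ K)) →
          P q (cutSize (complete q) K)
  bound K P = subst₂ P (count-not K) (≡.sym (complete-cut K))

  one-side : ∀ K → Proper K → q ≤ cutSize (complete q) K + hits id K
  one-side K proper = let x>0 , y>0 = proper-counts proper in
    subst (λ h → q ≤ cutSize (complete q) K + h) (count-sum K)
      (bound K (λ s c → s ≤ c + count K) (sum≤product+ x>0 y>0))

-- The spindle and exhaustive checks over its vertex sets.

∀Vec? : {P : Vec Bool n → Set} → (∀ v → Dec (P v)) → Dec (∀ v → P v)
∀Vec? {zero}  P? = map′ (λ { p [] → p }) (λ p → p []) (P? [])
∀Vec? {suc n} P? = map′ (λ { (t , f) (true ∷ v) → t v ; (t , f) (false ∷ v) → f v })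
                        (λ p → p ∘ (true ∷_) , p ∘ (false ∷_))
                        (∀Vec? (P? ∘ (true ∷_)) ×-dec ∀Vec? (P? ∘ (false ∷_)))

boundary : Graph n → (Fin n → Bool) → Fin n → Bool
boundary G K w = not (K w) ∧ (0 <ᵇ count (λ u → K u ∧ adj G u w))

boundary-elim : (G : Graph n) (K : Fin n → Bool) (w : Fin n) → boundary G K w ≡ true →
                K w ≡ false × ∃ λ u → K u ≡ true × adj G u w ≡ true
boundary-elim G K w e with K w
... | false with u , both ← count-∃ {P = λ u → K u ∧ adj G u w} (<ᵇ⇒< 0 _ (subst Bool.T (≡.sym e) _)) =
  refl , u , ∧-conicalˡ (K u) _ both , ∧-conicalʳ (K u) _ both

-- A boundary vertex outside `S` would belong to `K`. The boundary can thus stand in for `S`, which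
-- leaves statements about `K` alone to be checked.
boundary-avoided : (G : Graph n) (K S : Fin n → Bool) → Closed G K S → count (boundary G K) ≤ count S
boundary-avoided G K S closed = count-mono {P = boundary G K} {S} blocked
  where
  blocked : ∀ w → boundary G K w ≡ true → S w ≡ true
  blocked w w∈ with S w in w∈?S | boundary-elim G K w w∈
  ... | true  | _ = refl
  ... | false | w∉K , u , u∈ , uw = ⊥-elim (true≢false (closed u w u∈ uw w∈?S) w∉K)

pattern T = true
pattern F = false

-- The triangles 014 and 235, the edge 45, and the edges from 6 to 0, 1, 2 and 3.
spindle : Graph 7
spindle .adj u v = lookup (lookup rows u) v
  where
  rows : Vec (Vec Bool 7) 7
  rows = (F ∷ T ∷ F ∷ F ∷ T ∷ F ∷ T ∷ [])
       ∷ (T ∷ F ∷ F ∷ F ∷ T ∷ F ∷ T ∷ [])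
       ∷ (F ∷ F ∷ F ∷ T ∷ F ∷ T ∷ T ∷ [])
       ∷ (F ∷ F ∷ T ∷ F ∷ F ∷ T ∷ T ∷ [])
       ∷ (T ∷ T ∷ F ∷ F ∷ F ∷ T ∷ F ∷ [])
       ∷ (F ∷ F ∷ T ∷ T ∷ T ∷ F ∷ F ∷ [])
       ∷ (T ∷ T ∷ T ∷ T ∷ F ∷ F ∷ F ∷ [])
       ∷ []
spindle .sym = from-yes (all? λ u → all? λ v → adj spindle u v Bool.≟ adj spindle v u)
spindle .irrefl = from-yes (all? λ u → adj spindle u u Bool.≟ false)


spindle-left spindle-right : Fin 3 → Fin 7
spindle-left  = lookup (# 0 ∷ # 2 ∷ # 4 ∷ [])
spindle-right = lookup (# 1 ∷ # 3 ∷ # 5 ∷ [])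

spindle-link : Fin 7 → Fin 7 → Bool
spindle-link v w = 0 <ᵇ count (λ j → spindle-right j == v ∧ spindle-left j == w)

-- Decidable forms of the block conditions: a positive edge sum witnesses that `I` is not
-- independent, the alternative `≤ 0` says that `K` and its boundary exhaust the spindle, and all
-- cut bounds share one search.
SpindleSparse SpindleExpands SpindleCuts : (Fin 7 → Bool) → Set
SpindleSparse I = count I ≤ 2 ⊎ 0 < sumF (λ u → count (λ v → I u ∧ I v ∧ adj spindle u v))
SpindleExpands K = 0 < count K →
  (2 ≤ count ∂ ⊎ count (λ w → not (K w) ∧ not (∂ w)) ≤ 0) ×
  3 < hits spindle-right K + hits spindle-left K + count ∂
  where ∂ = boundary spindle K
SpindleCuts K =
  sumF (λ j → ⟦ K (spindle-left j) ⟧ * ⟦ not (K (spindle-right j)) ⟧) +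
  sumF (λ j → ⟦ K (spindle-right j) ⟧ * ⟦ not (K (spindle-left j)) ⟧) ≤ c ×
  (0 < count K → 0 < count (not ∘ K) → 3 ≤ c × 3 < c + ports × (2 ≤ count K → 6 ≤ c + ports))
  where
  c = cutSize spindle K
  ports = hits spindle-right K + hits spindle-left K

spindle-sparse : ∀ I → SpindleSparse I
-- Sums over `Fin 7` evaluate a set at concrete indices only, where `lookup (tabulate I)` reduces to
-- `I`; so a check over vectors covers all functions.
spindle-sparse I = from-yes (∀Vec? λ v → sparse? (lookup v)) (tabulate I)
  where
  sparse? : ∀ I → Dec (SpindleSparse I)
  sparse? I = (_ ≤? _) ⊎-dec (_ <? _)

spindle-expands : ∀ K → SpindleExpands K
spindle-expands K = from-yes (∀Vec? λ v → expands? (lookup v)) (tabulate K)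
  where
  expands? : ∀ K → Dec (SpindleExpands K)
  expands? K = (_ <? _) →-dec (((_ ≤? _) ⊎-dec (_ ≤? _)) ×-dec (_ <? _))

spindle-cuts : ∀ K → SpindleCuts K
spindle-cuts K = from-yes (∀Vec? λ v → cuts? (lookup v)) (tabulate K)
  where
  cuts? : ∀ K → Dec (SpindleCuts K)
  cuts? K = (_ ≤? _) ×-dec ((_ <? _) →-dec ((_ <? _) →-dec
              ((_ ≤? _) ×-dec ((_ <? _) ×-dec ((_ ≤? _) →-dec (_ ≤? _))))))

spindle-block : Block 3 3
spindle-block = record
  { size            = 7
  ; graph           = spindle
  ; left            = spindle-left
  ; right           = spindle-right
  ; link            = spindle-link
  ; left-injective  = from-yes (all? λ i → all? λ j → (spindle-left i ≟ spindle-left j) →-dec (i ≟ j))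
  ; right-injective = from-yes (all? λ i → all? λ j → (spindle-right i ≟ spindle-right j) →-dec (i ≟ j))
  ; link-ports      = from-yes (all? λ j → spindle-link (spindle-right j) (spindle-left j) Bool.≟ true)
  ; link-sum        = λ g → three (g (# 1) (# 0)) (g (# 3) (# 2)) (g (# 5) (# 4))
  ; regular         = from-yes (all? λ v →
      degree spindle v + (count (spindle-link v) + count (λ w → spindle-link w v)) ℕ.≟ 4)
  ; sparse          = sparse
  ; closed-fills    = fills
  ; closed-expands  = expands
  ; cut-columns     = λ K → proj₁ (spindle-cuts K)
  -- Every proper cut of the spindle has at least 3 edges, and here `q` is 3; this settles four
  -- fields.
  ; cut-alone       = λ K proper → m≤n⇒m≤1+n (inner K proper)
  ; cut-triple      = λ K proper → ≤-trans (m≤m+n 6 3) (*-monoʳ-≤ 3 (inner K proper))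
  ; cut-right       = λ K proper → m≤n⇒m≤n+o _ (inner K proper)
  ; cut-left        = λ K proper → m≤n⇒m≤n+o _ (inner K proper)
  ; cut-both        = λ K proper → proj₁ (proj₂ (cuts K proper))
  ; cut-pair        = λ K proper u v u≢v u∈ v∈ → proj₂ (proj₂ (cuts K proper)) (count-pair {K = K} u≢v u∈ v∈)
  }
  where
  -- The left side is the sum over all pairs once the zero entries of `spindle-link` are computed
  -- away.
  three : ∀ x y z → x + 0 + 0 + (y + 0 + 0 + (z + 0 + 0 + 0)) ≡ x + (y + (z + 0))
  three = solve-∀

  sparse : ∀ I → Independent spindle I → 3 * count I < 7
  sparse I independent with spindle-sparse I
  ... | inj₁ ≤2  = s≤s (*-monoʳ-≤ 3 ≤2)
  ... | inj₂ pos = contradiction pos (≤⇒≯ (≤-reflexive (trans (sumF-cong {7} λ u → count-none (no-edge u)) (sumF-0 7))))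
    where
    no-edge : ∀ u v → I u ∧ I v ∧ adj spindle u v ≡ false
    no-edge u v with I u in u∈ | I v in v∈
    ... | false | _     = refl
    ... | true  | false = refl
    ... | true  | true  = independent u v u∈ v∈

  cuts : ∀ K → Proper K → _
  cuts K proper = proj₂ (spindle-cuts K) (proj₁ (proper-counts proper)) (proj₂ (proper-counts proper))

  inner : ∀ K → Proper K → 3 ≤ cutSize spindle K
  inner K proper = proj₁ (cuts K proper)

  -- `S` has at most one vertex and contains the boundary of `K`, so the check leaves no vertex
  -- outside `K` and its boundary. An undeleted boundary vertex would lie in `K`.
  fills : ∀ K S → Closed spindle K S → 2 * count S < 3 →
          ∀ u v → K u ≡ true → S v ≡ false → K v ≡ true
  fills K S closed small u v u∈ v∉S with proj₁ (spindle-expands K (count-pos {P = K} u∈)) | K v in v∈?K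
  ... | _         | true  = refl
  ... | inj₁ ≥2   | false =
    contradiction small (≤⇒≯ (≤-trans (m≤m+n 3 1) (*-monoʳ-≤ 2 (≤-trans ≥2 (boundary-avoided spindle K S closed)))))
  ... | inj₂ none | false with boundary spindle K v in v∈?∂
  ...   | false = contradiction none (<⇒≱ (count-pos {P = λ w → not (K w) ∧ not (boundary spindle K w)} {v}
                                            (cong₂ (λ x y → not x ∧ not y) v∈?K v∈?∂)))
  ...   | true with _ , w , w∈ , wv ← boundary-elim spindle K v v∈?∂ =
    trans (≡.sym v∈?K) (closed w v w∈ wv v∉S)

  expands : ∀ K S → Closed spindle K S → Avoids K S → ∀ u → K u ≡ true →
            3 < hits spindle-right K + hits spindle-left K + count S
  expands K S closed _ u u∈ =
    <-≤-trans (proj₂ (spindle-expands K (count-pos {P = K} u∈)))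
              (+-monoʳ-≤ (hits spindle-right K + hits spindle-left K) (boundary-avoided spindle K S closed))

-- Assembling the infinite families.

Counterexample : (k N d e : ℕ) → Set
Counterexample k N d e = Σ ℕ λ n → N ≤ n × Σ (Graph n) λ G →
  VertexConnected d G × EssEdgeConnected e G × Regular d G × k ∣ edgeCount G × ¬ StarDecomposition k G

counterexample : ∀ t {q} → Block (3 + t) q → 2 * (3 + t) ≡ 3 + q → ∀ N →
                 Counterexample (3 + t) N (2 * (3 + t) ∸ 2) (4 * (3 + t) ∸ 6)
counterexample t {q} B 2k≡3+q N =
  subst₂ (Counterexample k N) (cong (_∸ 2) (≡.sym 2k≡3+q)) (≡.sym 4k∸6≡2q)
    (suc N * k * size , N≤n , ring , ring-connected 2k≡3+q , ring-essential , ring-regular ,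
     ring-edges 2k≡3+q (divides (suc N) refl) , ring-no-decomposition 2k≡3+q)
  where
  k : ℕ
  k = 3 + t
  open Block B
  -- The number of copies, `3 + (t + N * k)`, computes to `suc N * k`: it is divisible by `k` and
  -- grows with `N`.
  open Ring B (t + N * k)

  4k∸6≡2q : 4 * k ∸ 6 ≡ 2 * q
  4k∸6≡2q = begin
    4 * k ∸ 6         ≡⟨ cong (_∸ 6) (*-assoc 2 2 k) ⟩
    2 * (2 * k) ∸ 6   ≡⟨ cong (λ x → 2 * x ∸ 6) 2k≡3+q ⟩
    2 * (3 + q) ∸ 6   ≡⟨ cong (_∸ 6) (*-distribˡ-+ 2 3 q) ⟩
    6 + 2 * q ∸ 6     ≡⟨ m+n∸m≡n 6 (2 * q) ⟩
    2 * q             ∎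
    where open ≡-Reasoning

  size>0 : 0 < size
  -- The empty set is independent, so `sparse` makes the size positive.
  size>0 = ≤-<-trans z≤n (sparse (λ _ → false) (λ _ _ ()))

  N≤n : N ≤ suc N * k * size
  N≤n = begin
    N                      ≤⟨ n≤1+n N ⟩
    suc N                  ≤⟨ m≤m*n (suc N) k ⟩
    suc N * k              ≤⟨ m≤m*n (suc N * k) size ⦃ ℕ.>-nonZero size>0 ⦄ ⟩
    suc N * k * size       ∎
    where open ≤-Reasoning

theorem3p1 : (k : ℕ) → 3 ≤ k → (N : ℕ) →
    Σ ℕ λ n → N ≤ n × Σ (Graph n) λ G →
    VertexConnected (2 * k ∸ 2) G ×
    EssEdgeConnected (4 * k ∸ 6) G ×
    Regular (2 * k ∸ 2) G ×
    k ∣ edgeCount G ×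
    ¬ StarDecomposition k G
theorem3p1 (suc (suc (suc zero)))    (s≤s (s≤s (s≤s z≤n))) = counterexample 0 spindle-block refl
-- Here `k` is `4 + t`, and q = 2k - 3 is `5 + 2 * t`, which exceeds `k` by `1 + t`.
theorem3p1 (suc (suc (suc (suc t)))) (s≤s (s≤s (s≤s z≤n))) =
  counterexample (suc t) (complete-block {q = 5 + 2 * t} (slack t (k<q t)) (m≤m+n 3 _)) (2k≡3+q t)
  where
  k<q : ∀ t → suc (4 + t) + t ≡ 5 + 2 * t
  k<q = solve-∀
  2k≡3+q : ∀ t → 2 * (4 + t) ≡ 3 + (5 + 2 * t)
  2k≡3+q = solve-∀
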